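{- Let $G$ be a graph on vertex set $[n]=\{1,\dots,n\}$ with maximum degree $\Delta$ and clique number $\omega$. There exists a constant $C>0$ (depending only on $\Delta$ and $\omega$) such that the following holds. If $\mathcal{H}\subseteq\binom{[n]}{k}$ is a $G$-intersecting $k$-uniform hypergraph and $k < C n^{1/2}$, then \[ |\mathcal{H}| \le \binom{n}{k}-\binom{n-\omega}{k}+\binom{\omega(\Delta-\omega+1)}{2}\binom{n-\omega-2}{k-2}. \] Furthermore, if $\mathcal{H}$ is a $G$-intersecting $k$-uniform hypergraph on $[n]$ of maximum cardinality (with $k<Cn^{1/2}$), then there exists a maximum clique $K$ in $G$ such that $\mathcal{H}$ contains every $k$-subset of $[n]$ that intersects $K$.
   Context: Let $G$ be a graph on $[n]$ and $\mathcal{H}$ a hypergraph on $[n]$. $\mathcal{H}$ is called $G$-intersecting if for every pair of edges $e,f\in\mathcal{H}$ we have $e\cap f\neq\emptyset$, or there exist vertices $v\in e$, $w\in f$ such that $v$ and $w$ are adjacent in $G$. A hypergraph is $k$-uniform if all its edges are $k$-subsets of the vertex set. A maximum clique is a clique of size equal to the clique number $\omega$. -}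

module Defs where

open import Data.Nat using (ℕ; zero; suc; _+_; _*_; _∸_; _≤_)
open import Data.Nat.Combinatorics using (_C_)
open import Data.Fin using (Fin)
open import Data.Fin.Subset using (Subset; _∈_; _∩_; ∣_∣; Nonempty)
open import Data.Vec using (tabulate)
open import Data.Bool using (Bool; true; false)
open import Data.Integer using (+_)
open import Data.Rational using (ℚ; _/_)
open import Data.List using (List; length)
open import Data.List.Relation.Unary.All using (All)
open import Data.List.Relation.Unary.Unique.Propositional using (Unique)
import Data.List.Membership.Propositional as LM
open import Data.Product using (Σ; ∃; _×_)
open import Data.Sum using (_⊎_)
open import Relation.Binary.PropositionalEquality using (_≡_; _≢_)

ℕ→ℚ : ℕ → ℚ
ℕ→ℚ k = (+ k) / 1

record Graph (n : ℕ) : Set where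
  field
    adj   : Fin n → Fin n → Bool
    sym   : ∀ u v → adj u v ≡ adj v u
    irrfl : ∀ v → adj v v ≡ false

open Graph public

Adjacent : ∀ {n} → Graph n → Fin n → Fin n → Set
Adjacent G u v = adj G u v ≡ true

neighbourhood : ∀ {n} → Graph n → Fin n → Subset n
neighbourhood G v = tabulate (adj G v)

degree : ∀ {n} → Graph n → Fin n → ℕ
degree G v = ∣ neighbourhood G v ∣

MaxDegree : ∀ {n} → Graph n → ℕ → Set
MaxDegree {n} G Δ = (∀ v → degree G v ≤ Δ) × ∃ λ v → degree G v ≡ Δ

IsClique : ∀ {n} → Graph n → Subset n → Set
IsClique G K = ∀ u v → u ∈ K → v ∈ K → u ≢ v → Adjacent G u v

CliqueNumber : ∀ {n} → Graph n → ℕ → Set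
CliqueNumber {n} G ω =
  (∃ λ K → IsClique G K × ∣ K ∣ ≡ ω) × (∀ K → IsClique G K → ∣ K ∣ ≤ ω)

IsMaximumClique : ∀ {n} → Graph n → Subset n → Set
IsMaximumClique {n} G K =
  IsClique G K × (∀ K' → IsClique G K' → ∣ K' ∣ ≤ ∣ K ∣)

-- A hypergraph on [n]: a duplicate-free list of subsets of Fin n.
Hypergraph : ℕ → Set
Hypergraph n = List (Subset n)

UniformHG : ∀ {n} → ℕ → Hypergraph n → Set
UniformHG k H = Unique H × All (λ e → ∣ e ∣ ≡ k) H

GIntersecting : ∀ {n} → Graph n → Hypergraph n → Set
GIntersecting {n} G H =
  ∀ e f → e LM.∈ H → f LM.∈ H →
    Nonempty (e ∩ f) ⊎ (∃ λ v → ∃ λ w → v ∈ e × w ∈ f × Adjacent G v w)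

-- binomial(m, k - 2), with the convention that it is 0 when k < 2
binomMinus2 : ℕ → ℕ → ℕ
binomMinus2 m zero = 0
binomMinus2 m (suc zero) = 0
binomMinus2 m (suc (suc j)) = m C j

bound : (n k Δ ω : ℕ) → ℕ
bound n k Δ ω =
  (n C k ∸ (n ∸ ω) C k) + ((ω * ((Δ + 1) ∸ ω)) C 2) * binomMinus2 (n ∸ ω ∸ 2) k

{-# OPTIONS --safe #-}

-- Write d = Δ + 1, β j for the number of k-sets through a fixed j-set and
-- deg S for the number of edges of H containing S.  Call S a cover if every
-- edge meets the closed neighbourhood N[S].  If S is not a cover, some edge f
-- misses N[S], and every edge through S contains one of the at most k d
-- vertices of N[f], all outside S; so deg S ≤ k d · max deg (S ∪ {w}).  When
-- n ≥ 4 d² k², passing from j to j + 1 costs β a factor 4 d · k d, hence each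
-- such step gains a factor 4 d.  With C = 1/(2d):
--
--  * if the least cover S has s ≥ 2 vertices, then |H| ≤ s d (4 d)^(1 - s) β 1
--    (first branch over N[S], then s - 1 times over uncovered sets), so
--    |H| ≤ β 1 / 2;
--  * if s = 1, let K be the set of heavy vertices, those with
--    4 d · deg u > β 1.  Each is a cover and K is a clique, and
--    |H| ≤ |K| β 1 + β 1 / 4 since all edges meet N[v] for some v.
--
-- The family of all k-sets meeting a maximum clique has more than
-- (ω - 1/2) β 1 members, so a smaller H is below the bound, and otherwise K is
-- a maximum clique.  An edge missing K meets N[v] for every v in K, hence
-- contains two of the at most ω (Δ - ω + 1) outer neighbours of K, one alone
-- being adjacent to all of K only if K could be enlarged.  Since every vertex
-- of K is a cover, adding to H any k-set meeting K keeps it G-intersecting.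
module Submission where

open import Defs hiding (sym)
open import Data.Bool using (true; false) renaming (_≟_ to _≟B_)
open import Data.Fin using (Fin; zero; suc)
open import Data.Fin.Properties using (suc-injective; any?) renaming (_≟_ to _≟F_)
open import Data.Fin.Subset using (Subset; _∈_; _∉_; _⊆_; _∩_; _∪_; _─_; ∁; ⁅_⁆; ⊥; ∣_∣; Nonempty; inside; outside)
open import Data.Fin.Subset.Properties using (_∈?_; _⊆?_; drop-∷-⊆; ∣⁅x⁆∣≡1; x∈⁅x⁆; x∈⁅y⁆⇒x≡y; p⊆q⇒∣p∣≤∣q∣; ∣⊥∣≡0; ∣∁p∣≡n∸∣p∣; ∣p∩q∣≤∣q∣; ∉⊥; ∣p∣≤n; x∈p∪q⁺; x∈p∪q⁻; x∈p∩q⁺; x∈p∩q⁻; x∈p∧x∉q⇒x∈p─q; p─q⊆p; nonempty?; anySubset?)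
open import Data.List using (List; []; _∷_; _++_; length; map; filter)
open import Data.List.Properties using (length-map; length-++; filter-none)
open import Data.List.Relation.Unary.All as All using (All; []; _∷_)
open import Data.List.Relation.Unary.All.Properties using (¬All⇒Any¬)
open import Data.List.Relation.Unary.AllPairs using ([]; _∷_)
open import Data.List.Relation.Unary.Any using (here; there)
open import Data.List.Relation.Unary.Unique.Propositional using (Unique)
import Data.List.Relation.Unary.Unique.Propositional.Properties as Unique
import Data.List.Membership.Propositional as LM
open import Data.List.Membership.Propositional.Properties using (∈-filter⁻; ∈-++⁺ˡ; ∈-++⁺ʳ; ∈-++⁻; ∈-map⁺; ∈-map⁻; ∈-∃++)
import Data.List.Membership.DecPropositional as DecMembership
open import Data.Nat using (ℕ; zero; suc; _+_; _*_; _∸_; _^_; _≤_; _<_; z≤n; s≤s; z<s)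
open import Data.Nat.Combinatorics using (_C_; nC1≡n; nCk+nC[k+1]≡[n+1]C[k+1])
open import Data.Nat.Properties hiding (suc-injective)
open import Data.Nat.Tactic.RingSolver using (solve-∀)
open import Data.Product using (Σ; ∃; _×_; _,_; proj₁; proj₂)
import Data.Integer as ℤ
import Data.Integer.Properties as ℤ
import Data.Rational as ℚ
import Data.Rational.Properties as ℚ
open import Data.Rational using (ℚ; Positive)
open import Data.Rational.Unnormalised as ℚᵘ using (mkℚᵘ)
import Data.Rational.Unnormalised.Properties as ℚᵘ
open import Data.Sum using (_⊎_; inj₁; inj₂)
open import Data.Vec using ([]; _∷_; tabulate; here; there)
open import Data.Vec.Properties using (≡-dec; ∷-injectiveʳ; lookup∘tabulate; lookup⇒[]=; []=⇒lookup)
open import Level using (0ℓ)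
open import Function using (_∘_)
open import Relation.Binary.PropositionalEquality using (_≡_; _≢_; refl; sym; trans; cong; cong₂; subst; subst₂; module ≡-Reasoning)
open import Relation.Nullary using (¬_; yes; no; contradiction; ¬?; does; _×-dec_)
open import Relation.Nullary.Decidable using (dec-true; decidable-stable)
open import Relation.Unary using (Pred; Decidable)

-- Binomial coefficients

pascal : ∀ n k → suc n C suc k ≡ n C k + n C suc k
pascal n k = sym (nCk+nC[k+1]≡[n+1]C[k+1] n k)

C-monoˡ-≤ : ∀ k {m n} → m ≤ n → m C k ≤ n C k
C-monoˡ-≤ zero    _ = ≤-refl
C-monoˡ-≤ (suc k) z≤n = z≤n
C-monoˡ-≤ (suc k) (s≤s {m} {n} m≤n) rewrite pascal m k | pascal n k =
  +-mono-≤ (C-monoˡ-≤ k m≤n) (C-monoˡ-≤ (suc k) m≤n)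

0<nCk : ∀ {n k} → k ≤ n → 0 < n C k
0<nCk z≤n = z<s
0<nCk (s≤s {k} {n} k≤n) rewrite pascal n k = ≤-trans (0<nCk k≤n) (m≤m+n (n C k) (n C suc k))

C-absorption : ∀ n k → suc n * (n C k) ≡ suc k * (suc n C suc k)
C-absorption zero zero    = refl
C-absorption zero (suc k) = sym (*-zeroʳ k)
C-absorption (suc n) zero = begin
  suc (suc n) * 1             ≡⟨ *-comm (suc (suc n)) 1 ⟩
  1 * suc (suc n)             ≡⟨ cong (1 *_) (nC1≡n (suc (suc n))) ⟨
  1 * (suc (suc n) C 1)       ∎
  where open ≡-Reasoning
C-absorption (suc n) (suc k) = begin
  suc (suc n) * x                                 ≡⟨⟩
  x + suc n * x                                   ≡⟨ cong (λ z → x + suc n * z) (pascal n k) ⟩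
  x + suc n * (n C k + n C suc k)                 ≡⟨ cong (x +_) (*-distribˡ-+ (suc n) (n C k) (n C suc k)) ⟩
  x + (suc n * (n C k) + suc n * (n C suc k))     ≡⟨ cong (x +_) (cong₂ _+_ (C-absorption n k) (C-absorption n (suc k))) ⟩
  x + (suc k * x + suc (suc k) * y)               ≡⟨ regroup k x y ⟩
  suc (suc k) * (x + y)                           ≡⟨ cong (suc (suc k) *_) (pascal (suc n) (suc k)) ⟨
  suc (suc k) * (suc (suc n) C suc (suc k))       ∎
  where
  open ≡-Reasoning
  x = suc n C suc k
  y = suc n C suc (suc k)
  regroup : ∀ k x y → x + (suc k * x + suc (suc k) * y) ≡ suc (suc k) * (x + y)
  regroup = solve-∀

-- The number of k-sets obtained by enlarging a given j-set with elements of
-- a disjoint f-set; it is 0 when k < j.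
extensions : ℕ → ℕ → ℕ → ℕ
extensions f k       zero    = f C k
extensions f zero    (suc j) = 0
extensions f (suc k) (suc j) = extensions f k j

extensions-pascal : ∀ f k j → extensions (suc f) (suc k) j ≡ extensions f (suc k) j + extensions f k j
extensions-pascal f k       zero          = trans (pascal f k) (+-comm (f C k) (f C suc k))
extensions-pascal f zero    (suc zero)    = refl
extensions-pascal f zero    (suc (suc j)) = refl
extensions-pascal f (suc k) (suc j)       = extensions-pascal f k j

extensions-zero : ∀ f j → extensions (suc f) zero j ≡ extensions f zero j
extensions-zero f zero    = refl
extensions-zero f (suc j) = refl

binomMinus2≡extensions : ∀ m k → binomMinus2 m k ≡ extensions m k 2
binomMinus2≡extensions m zero          = refl
binomMinus2≡extensions m (suc zero)    = refl
binomMinus2≡extensions m (suc (suc k)) = refl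

-- Prescribing one more element multiplies the count by `(k - j) / (n - j)`, which is at most
-- `k / n` because `k ≤ n`. The case `j = 0` is absorption; the inductive step adds `x ≤ y` to the
-- induction hypothesis, which itself follows from that hypothesis and `k ≤ n`.
extensions-ratio : ∀ n k j → k ≤ n → n * extensions (n ∸ suc j) k (suc j) ≤ k * extensions (n ∸ j) k j
extensions-ratio n zero j _ = ≤-reflexive (*-zeroʳ n)
extensions-ratio (suc n) (suc k) zero _ = ≤-reflexive (C-absorption n k)
extensions-ratio (suc n) (suc k) (suc j) (s≤s k≤n) = +-mono-≤ (x≤y k k≤n ih) ih
  where
  x = λ k → extensions (n ∸ suc j) k (suc j)
  y = λ k → extensions (n ∸ j) k j
  ih : n * x k ≤ k * y k
  ih = extensions-ratio n k j k≤n
  x≤y : ∀ k → k ≤ n → n * x k ≤ k * y k → x k ≤ y k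
  x≤y zero    _   _  = z≤n
  x≤y (suc k) k≤n le = *-cancelˡ-≤ (suc k) (≤-trans (*-monoˡ-≤ (x (suc k)) k≤n) le)

-- Points are deleted one at a time; each deletion loses the sets through the deleted point, and
-- there are at most `(n ∸ 1) C k` of these.
C-decrement : ∀ n k i → n C suc k ≤ (n ∸ i) C suc k + i * ((n ∸ 1) C k)
C-decrement n k zero = m≤m+n _ 0
C-decrement zero k (suc i) = z≤n
C-decrement (suc n) k (suc i) = begin
  suc n C suc k                                ≡⟨ pascal n k ⟩
  n C k + n C suc k                            ≤⟨ +-monoʳ-≤ (n C k) (C-decrement n k i) ⟩
  n C k + ((n ∸ i) C suc k + i * ((n ∸ 1) C k)) ≤⟨ +-monoʳ-≤ (n C k) (+-monoʳ-≤ ((n ∸ i) C suc k) (*-monoʳ-≤ i (C-monoˡ-≤ k (m∸n≤m n 1)))) ⟩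
  n C k + ((n ∸ i) C suc k + i * (n C k))      ≡⟨ regroup (n C k) ((n ∸ i) C suc k) i ⟩
  (n ∸ i) C suc k + suc i * (n C k)            ∎
  where
  open ≤-Reasoning
  regroup : ∀ a b i → a + (b + i * a) ≡ b + suc i * a
  regroup = solve-∀

-- A truncated Bonferroni inequality for the k-sets meeting a fixed i-set.
meeting-lower : ∀ n k i → i ≤ n →
  (n ∸ i) C suc k + i * extensions (n ∸ 1) (suc k) 1 ≤ n C suc k + i * i * extensions (n ∸ 2) (suc k) 2
meeting-lower n k zero _ = ≤-refl
meeting-lower n k (suc i) i<n = begin
  (n ∸ suc i) C suc k + suc i * c₁                        ≡⟨ regroup₁ ((n ∸ suc i) C suc k) i c₁ ⟩
  -- The new point lies in `c₁` sets, of which at most `i * c₂` meet the `i` points already treated;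
  -- the others avoid all of them.
  c₁ + ((n ∸ suc i) C suc k + i * c₁)                     ≤⟨ +-monoˡ-≤ _ (decrement k) ⟩
  ((n ∸ suc i) C k + i * c₂) + ((n ∸ suc i) C suc k + i * c₁) ≡⟨ regroup₂ ((n ∸ suc i) C k) ((n ∸ suc i) C suc k) (i * c₂) (i * c₁) ⟩
  ((n ∸ suc i) C k + (n ∸ suc i) C suc k) + i * c₁ + i * c₂ ≡⟨ cong (λ z → z + i * c₁ + i * c₂) (trans (sym (pascal (n ∸ suc i) k)) (cong (_C suc k) (sym (+-∸-assoc 1 i<n)))) ⟩
  (n ∸ i) C suc k + i * c₁ + i * c₂                       ≤⟨ +-monoˡ-≤ (i * c₂) (meeting-lower n k i (<⇒≤ i<n)) ⟩
  n C suc k + i * i * c₂ + i * c₂                         ≤⟨ ≤-reflexive (+-assoc (n C suc k) _ _) ⟩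
  -- The error coefficient `i * i + i` is rounded up to the next square.
  n C suc k + (i * i * c₂ + i * c₂)                       ≤⟨ +-monoʳ-≤ (n C suc k) (m≤m+n _ (suc i * c₂)) ⟩
  n C suc k + (i * i * c₂ + i * c₂ + suc i * c₂)          ≡⟨ cong (n C suc k +_) (square i c₂) ⟩
  n C suc k + suc i * suc i * c₂                          ∎
  where
  open ≤-Reasoning
  c₁ = (n ∸ 1) C k
  c₂ = extensions (n ∸ 2) k 1
  regroup₁ : ∀ a i c → a + suc i * c ≡ c + (a + i * c)
  regroup₁ = solve-∀
  regroup₂ : ∀ a b x y → (a + x) + (b + y) ≡ (a + b) + y + x
  regroup₂ = solve-∀
  square : ∀ i c → i * i * c + i * c + suc i * c ≡ suc i * suc i * c
  square = solve-∀
  decrement : ∀ k → (n ∸ 1) C k ≤ (n ∸ suc i) C k + i * extensions (n ∸ 2) k 1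
  decrement zero = m≤m+n 1 _
  decrement (suc k) = begin
    (n ∸ 1) C suc k                                    ≤⟨ C-decrement (n ∸ 1) k i ⟩
    (n ∸ 1 ∸ i) C suc k + i * ((n ∸ 1 ∸ 1) C k)        ≡⟨ cong₂ (λ x y → x C suc k + i * (y C k)) (∸-+-assoc n 1 i) (∸-+-assoc n 1 1) ⟩
    (n ∸ suc i) C suc k + i * ((n ∸ 2) C k)            ∎

-- Lists as finite multisets

module _ {A : Set} where

  unique-⊆⇒length-≤ : {xs ys : List A} → Unique xs → (∀ {x} → x LM.∈ xs → x LM.∈ ys) → length xs ≤ length ys
  unique-⊆⇒length-≤ [] _ = z≤n
  unique-⊆⇒length-≤ {x ∷ xs} (x∉xs ∷ u) sub with as , bs , refl ← ∈-∃++ (sub (here refl)) = begin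
    suc (length xs)                ≤⟨ s≤s (unique-⊆⇒length-≤ u remove) ⟩
    suc (length (as ++ bs))        ≡⟨ cong suc (length-++ as) ⟩
    suc (length as + length bs)    ≡⟨ +-suc (length as) (length bs) ⟨
    length as + suc (length bs)    ≡⟨ length-++ as ⟨
    length (as ++ x ∷ bs)          ∎
    where
    open ≤-Reasoning
    remove : ∀ {y} → y LM.∈ xs → y LM.∈ as ++ bs
    remove y∈xs with ∈-++⁻ as (sub (there y∈xs))
    ... | inj₁ y∈as          = ∈-++⁺ˡ y∈as
    ... | inj₂ (here refl)   = contradiction refl (All.lookup x∉xs y∈xs)
    ... | inj₂ (there y∈bs)  = ∈-++⁺ʳ as y∈bs

  empty-or-inhabited : (xs : List A) → xs ≡ [] ⊎ ∃ λ x → x LM.∈ xs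
  empty-or-inhabited []      = inj₁ refl
  empty-or-inhabited (x ∷ _) = inj₂ (x , here refl)

  module _ {P : Pred A 0ℓ} (P? : Decidable P) where

    length-filter-split : ∀ xs → length (filter P? xs) + length (filter (¬? ∘ P?) xs) ≡ length xs
    length-filter-split [] = refl
    length-filter-split (x ∷ xs) with does (P? x)
    ... | true  = cong suc (length-filter-split xs)
    ... | false = trans (+-suc _ _) (cong suc (length-filter-split xs))

    length-filter-mono : {R : Pred A 0ℓ} (R? : Decidable R) → (∀ {x} → P x → R x) →
      ∀ xs → length (filter P? xs) ≤ length (filter R? xs)
    length-filter-mono R? f [] = z≤n
    length-filter-mono R? f (x ∷ xs) with P? x | R? x
    ... | yes _ | yes _ = s≤s (length-filter-mono R? f xs)
    ... | yes p | no ¬r = contradiction (f p) ¬r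
    ... | no _  | yes _ = m≤n⇒m≤1+n (length-filter-mono R? f xs)
    ... | no _  | no _  = length-filter-mono R? f xs

    length-filter-filter : {Q R : Pred A 0ℓ} (Q? : Decidable Q) (R? : Decidable R) → (∀ {x} → P x → Q x → R x) →
      ∀ xs → length (filter Q? (filter P? xs)) ≤ length (filter R? xs)
    length-filter-filter Q? R? f [] = z≤n
    length-filter-filter Q? R? f (x ∷ xs) with P? x
    length-filter-filter Q? R? f (x ∷ xs) | no _ with R? x
    ... | yes _ = m≤n⇒m≤1+n (length-filter-filter Q? R? f xs)
    ... | no _  = length-filter-filter Q? R? f xs
    length-filter-filter Q? R? f (x ∷ xs) | yes p with Q? x | R? x
    ... | yes _ | yes _ = s≤s (length-filter-filter Q? R? f xs)
    ... | yes q | no ¬r = contradiction (f p q) ¬r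
    ... | no _  | yes _ = m≤n⇒m≤1+n (length-filter-filter Q? R? f xs)
    ... | no _  | no _  = length-filter-filter Q? R? f xs

    length-filter-filter-≤ : ∀ {Q : Pred A 0ℓ} (Q? : Decidable Q) xs → length (filter Q? (filter P? xs)) ≤ length (filter Q? xs)
    length-filter-filter-≤ Q? = length-filter-filter Q? Q? (λ _ q → q)

  -- The factor `c` plays the part of a denominator: it lets a bound `b / c` on each part be used
  -- within the natural numbers. Elements caught by the first index of `W` are filtered out before
  -- the remaining indices are treated.
  union-bound : ∀ {m} {Q : Fin m → Pred A 0ℓ} (Q? : ∀ i → Decidable (Q i)) (c b : ℕ) (W : Subset m) (xs : List A) →
    (∀ {x} → x LM.∈ xs → ∃ λ i → i ∈ W × Q i x) →
    (∀ {i} → i ∈ W → c * length (filter (Q? i) xs) ≤ b) →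
    c * length xs ≤ ∣ W ∣ * b
  union-bound Q? c b [] [] cover small = ≤-reflexive (*-zeroʳ c)
  union-bound Q? c b [] (x ∷ xs) cover small with () , _ ← cover (here refl)
  union-bound {Q = Q} Q? c b (outside ∷ W) xs cover small =
    union-bound (Q? ∘ suc) c b W xs cover′ (λ i∈ → small (there i∈))
    where
    cover′ : ∀ {x} → x LM.∈ xs → ∃ λ i → i ∈ W × Q (suc i) x
    cover′ x∈ with cover x∈
    ... | suc i , there i∈W , q = i , i∈W , q
  union-bound {Q = Q} Q? c b (inside ∷ W) xs cover small = begin
    c * length xs                          ≡⟨ cong (c *_) (length-filter-split (Q? zero) xs) ⟨
    c * (length xs₀ + length xs₁)          ≡⟨ *-distribˡ-+ c (length xs₀) (length xs₁) ⟩
    c * length xs₀ + c * length xs₁        ≤⟨ +-mono-≤ (small here) rest ⟩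
    b + ∣ W ∣ * b                          ∎
    where
    open ≤-Reasoning
    xs₀ = filter (Q? zero) xs
    xs₁ = filter (¬? ∘ Q? zero) xs
    cover′ : ∀ {x} → x LM.∈ xs₁ → ∃ λ i → i ∈ W × Q (suc i) x
    cover′ x∈ with ∈-filter⁻ (¬? ∘ Q? zero) {xs = xs} x∈
    ... | x∈xs , ¬q with cover x∈xs
    ... | zero  , _         , q = contradiction q ¬q
    ... | suc i , there i∈W , q = i , i∈W , q
    rest : c * length xs₁ ≤ ∣ W ∣ * b
    rest = union-bound (Q? ∘ suc) c b W xs₁ cover′
      (λ {i} i∈ → ≤-trans (*-monoʳ-≤ c (length-filter-filter-≤ (¬? ∘ Q? zero) (Q? (suc i)) xs)) (small (there i∈)))

  -- Elements caught by the first index have a partner among the remaining ones, which is a union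
  -- bound; all others have both indices in the tail. The two counts combine by Pascal's rule.
  pair-bound : ∀ {m} {Q : Fin m → Pred A 0ℓ} (Q? : ∀ i → Decidable (Q i)) (b : ℕ) (W : Subset m) (xs : List A) →
    (∀ {x} → x LM.∈ xs → ∃ λ i → ∃ λ j → i ≢ j × (i ∈ W × Q i x) × (j ∈ W × Q j x)) →
    (∀ {i j} → i ≢ j → i ∈ W → j ∈ W → length (filter (λ x → Q? i x ×-dec Q? j x) xs) ≤ b) →
    length xs ≤ (∣ W ∣ C 2) * b
  pair-bound Q? b [] [] cover small = z≤n
  pair-bound Q? b [] (x ∷ xs) cover small with () , _ ← cover (here refl)
  pair-bound {Q = Q} Q? b (outside ∷ W) xs cover small =
    pair-bound (Q? ∘ suc) b W xs cover′ (λ i≢j i∈ j∈ → small (i≢j ∘ suc-injective) (there i∈) (there j∈))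
    where
    cover′ : ∀ {x} → x LM.∈ xs → ∃ λ i → ∃ λ j → i ≢ j × (i ∈ W × Q (suc i) x) × (j ∈ W × Q (suc j) x)
    cover′ x∈ with cover x∈
    ... | suc i , suc j , i≢j , (there i∈ , qi) , (there j∈ , qj) = i , j , i≢j ∘ cong suc , (i∈ , qi) , (j∈ , qj)
  pair-bound {Q = Q} Q? b (inside ∷ W) xs cover small = begin
    length xs                              ≡⟨ length-filter-split (Q? zero) xs ⟨
    length xs₀ + length xs₁                ≤⟨ +-mono-≤ first rest ⟩
    ∣ W ∣ * b + (∣ W ∣ C 2) * b            ≡⟨ *-distribʳ-+ b ∣ W ∣ (∣ W ∣ C 2) ⟨
    (∣ W ∣ + ∣ W ∣ C 2) * b                ≡⟨ cong (λ z → (z + ∣ W ∣ C 2) * b) (nC1≡n ∣ W ∣) ⟨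
    (∣ W ∣ C 1 + ∣ W ∣ C 2) * b            ≡⟨ cong (_* b) (pascal ∣ W ∣ 1) ⟨
    (suc ∣ W ∣ C 2) * b                    ∎
    where
    open ≤-Reasoning
    xs₀ = filter (Q? zero) xs
    xs₁ = filter (¬? ∘ Q? zero) xs
    cover₀ : ∀ {x} → x LM.∈ xs₀ → ∃ λ i → i ∈ W × Q (suc i) x
    cover₀ x∈ with cover (proj₁ (∈-filter⁻ (Q? zero) {xs = xs} x∈))
    ... | suc i , _     , _   , (there i∈ , q) , _            = i , i∈ , q
    ... | zero  , suc j , _   , _              , (there j∈ , q) = j , j∈ , q
    ... | zero  , zero  , i≢j , _              , _            = contradiction refl i≢j
    cover₁ : ∀ {x} → x LM.∈ xs₁ → ∃ λ i → ∃ λ j → i ≢ j × (i ∈ W × Q (suc i) x) × (j ∈ W × Q (suc j) x)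
    cover₁ x∈ with ∈-filter⁻ (¬? ∘ Q? zero) {xs = xs} x∈
    ... | x∈xs , ¬q with cover x∈xs
    ... | zero  , _     , _   , (_ , q) , _ = contradiction q ¬q
    ... | suc _ , zero  , _   , _ , (_ , q) = contradiction q ¬q
    ... | suc i , suc j , i≢j , (there i∈ , qi) , (there j∈ , qj) = i , j , i≢j ∘ cong suc , (i∈ , qi) , (j∈ , qj)
    first : length xs₀ ≤ ∣ W ∣ * b
    first = subst (_≤ ∣ W ∣ * b) (*-identityˡ (length xs₀))
      (union-bound (Q? ∘ suc) 1 b W xs₀ cover₀
        (λ {i} i∈ → ≤-trans (≤-reflexive (*-identityˡ _))
          (≤-trans (length-filter-filter (Q? zero) (Q? (suc i)) (λ x → Q? zero x ×-dec Q? (suc i) x) _,_ xs)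
            (small (λ ()) here (there i∈)))))
    rest : length xs₁ ≤ (∣ W ∣ C 2) * b
    rest = pair-bound (Q? ∘ suc) b W xs₁ cover₁ (λ {i} {j} i≢j i∈ j∈ →
      ≤-trans (length-filter-filter-≤ (¬? ∘ Q? zero) (λ x → Q? (suc i) x ×-dec Q? (suc j) x) xs)
        (small (i≢j ∘ suc-injective) (there i∈) (there j∈)))

-- Enumerating k-sets

-- The k-sets that contain S and avoid T.
subsets : ∀ {n} → Subset n → Subset n → ℕ → List (Subset n)
subsets []            []            zero    = [] ∷ []
subsets []            []            (suc k) = []
subsets (inside ∷ S)  (inside ∷ T)  k       = []
subsets (inside ∷ S)  (outside ∷ T) zero    = []
subsets (inside ∷ S)  (outside ∷ T) (suc k) = map (inside ∷_) (subsets S T k)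
subsets (outside ∷ S) (inside ∷ T)  k       = map (outside ∷_) (subsets S T k)
subsets (outside ∷ S) (outside ∷ T) zero    = map (outside ∷_) (subsets S T zero)
subsets (outside ∷ S) (outside ∷ T) (suc k) = map (outside ∷_) (subsets S T (suc k)) ++ map (inside ∷_) (subsets S T k)

Disjoint : ∀ {n} → Subset n → Subset n → Set
Disjoint S T = ∀ {x} → x ∈ S → x ∉ T

Disjoint-tail : ∀ {n s t} {S T : Subset n} → Disjoint (s ∷ S) (t ∷ T) → Disjoint S T
Disjoint-tail dis x∈S x∈T = dis (there x∈S) (there x∈T)

-- Counting the free coordinates as `∣ ∁ (S ∪ T) ∣` suits the recursion, since a free coordinate
-- raises this number by exactly one and its two choices match `extensions-pascal`. The form with
-- subtraction is derived afterwards.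
length-subsets-free : ∀ {n} (S T : Subset n) k → Disjoint S T →
  length (subsets S T k) ≡ extensions (∣ ∁ (S ∪ T) ∣) k (∣ S ∣)
length-subsets-free [] [] zero    _ = refl
length-subsets-free [] [] (suc k) _ = refl
length-subsets-free (inside ∷ S)  (inside ∷ T)  k       dis = contradiction here (dis here)
length-subsets-free (inside ∷ S)  (outside ∷ T) zero    dis = refl
length-subsets-free (inside ∷ S)  (outside ∷ T) (suc k) dis =
  trans (length-map _ (subsets S T k)) (length-subsets-free S T k (Disjoint-tail dis))
length-subsets-free (outside ∷ S) (inside ∷ T)  k       dis =
  trans (length-map _ (subsets S T k)) (length-subsets-free S T k (Disjoint-tail dis))
length-subsets-free (outside ∷ S) (outside ∷ T) zero    dis =
  trans (length-map _ (subsets S T zero))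
    (trans (length-subsets-free S T zero (Disjoint-tail dis)) (sym (extensions-zero (∣ ∁ (S ∪ T) ∣) (∣ S ∣))))
length-subsets-free (outside ∷ S) (outside ∷ T) (suc k) dis = begin
  length (map (outside ∷_) xs ++ map (inside ∷_) ys)          ≡⟨ length-++ (map (outside ∷_) xs) ⟩
  length (map (outside ∷_) xs) + length (map (inside ∷_) ys)  ≡⟨ cong₂ _+_ (length-map _ xs) (length-map _ ys) ⟩
  length xs + length ys                                       ≡⟨ cong₂ _+_ (length-subsets-free S T (suc k) (Disjoint-tail dis)) (length-subsets-free S T k (Disjoint-tail dis)) ⟩
  extensions f (suc k) ∣ S ∣ + extensions f k ∣ S ∣           ≡⟨ extensions-pascal f k ∣ S ∣ ⟨
  extensions (suc f) (suc k) ∣ S ∣                            ∎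
  where
  open ≡-Reasoning
  f = ∣ ∁ (S ∪ T) ∣
  xs = subsets S T (suc k)
  ys = subsets S T k

∣p∪q∣≡∣p∣+∣q∣ : ∀ {n} (p q : Subset n) → Disjoint p q → ∣ p ∪ q ∣ ≡ ∣ p ∣ + ∣ q ∣
∣p∪q∣≡∣p∣+∣q∣ [] [] _ = refl
∣p∪q∣≡∣p∣+∣q∣ (inside ∷ p)  (inside ∷ q)  dis = contradiction here (dis here)
∣p∪q∣≡∣p∣+∣q∣ (inside ∷ p)  (outside ∷ q) dis = cong suc (∣p∪q∣≡∣p∣+∣q∣ p q (Disjoint-tail dis))
∣p∪q∣≡∣p∣+∣q∣ (outside ∷ p) (inside ∷ q)  dis = trans (cong suc (∣p∪q∣≡∣p∣+∣q∣ p q (Disjoint-tail dis))) (sym (+-suc (∣ p ∣) (∣ q ∣)))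
∣p∪q∣≡∣p∣+∣q∣ (outside ∷ p) (outside ∷ q) dis = ∣p∪q∣≡∣p∣+∣q∣ p q (Disjoint-tail dis)

length-subsets : ∀ {n} (S T : Subset n) k → Disjoint S T →
  length (subsets S T k) ≡ extensions (n ∸ ∣ T ∣ ∸ ∣ S ∣) k ∣ S ∣
length-subsets {n} S T k dis = trans (length-subsets-free S T k dis) (cong (λ f → extensions f k ∣ S ∣) free)
  where
  open ≡-Reasoning
  free : ∣ ∁ (S ∪ T) ∣ ≡ n ∸ ∣ T ∣ ∸ ∣ S ∣
  free = begin
    ∣ ∁ (S ∪ T) ∣            ≡⟨ ∣∁p∣≡n∸∣p∣ (S ∪ T) ⟩
    n ∸ ∣ S ∪ T ∣            ≡⟨ cong (n ∸_) (trans (∣p∪q∣≡∣p∣+∣q∣ S T dis) (+-comm (∣ S ∣) (∣ T ∣))) ⟩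
    n ∸ (∣ T ∣ + ∣ S ∣)      ≡⟨ ∸-+-assoc n (∣ T ∣) (∣ S ∣) ⟨
    n ∸ ∣ T ∣ ∸ ∣ S ∣        ∎

∈-subsets⁺ : ∀ {n} {S T : Subset n} e → S ⊆ e → Disjoint e T → e LM.∈ subsets S T ∣ e ∣
∈-subsets⁺ {S = []} {[]} [] _ _ = here refl
∈-subsets⁺ {S = inside ∷ S}  {_ ∷ T}       (outside ∷ e) S⊆e dis = contradiction (S⊆e here) λ ()
∈-subsets⁺ {S = _ ∷ S}       {inside ∷ T}  (inside ∷ e)  S⊆e dis = contradiction here (dis here)
∈-subsets⁺ {S = inside ∷ S}  {outside ∷ T} (inside ∷ e)  S⊆e dis =
  ∈-map⁺ _ (∈-subsets⁺ e (drop-∷-⊆ S⊆e) (Disjoint-tail dis))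
∈-subsets⁺ {S = outside ∷ S} {inside ∷ T}  (outside ∷ e) S⊆e dis =
  ∈-map⁺ _ (∈-subsets⁺ e (drop-∷-⊆ S⊆e) (Disjoint-tail dis))
∈-subsets⁺ {S = outside ∷ S} {outside ∷ T} (inside ∷ e)  S⊆e dis =
  ∈-++⁺ʳ (map (outside ∷_) (subsets S T (suc ∣ e ∣))) (∈-map⁺ _ (∈-subsets⁺ e (drop-∷-⊆ S⊆e) (Disjoint-tail dis)))
∈-subsets⁺ {S = outside ∷ S} {outside ∷ T} (outside ∷ e) S⊆e dis
  with ∣ e ∣ | ∈-subsets⁺ e (drop-∷-⊆ S⊆e) (Disjoint-tail dis)
... | zero  | e∈ = ∈-map⁺ _ e∈
... | suc k | e∈ = ∈-++⁺ˡ (∈-map⁺ _ e∈)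

∈-subsets⁻ : ∀ {n} (S T : Subset n) k {e} → e LM.∈ subsets S T k → ∣ e ∣ ≡ k × Disjoint e T
∈-subsets⁻ [] [] zero (here refl) = refl , λ ()
∈-subsets⁻ (inside ∷ S) (outside ∷ T) (suc k) e∈ with e′ , e′∈ , refl ← ∈-map⁻ (inside ∷_) {xs = subsets S T k} e∈
  with size , dis ← ∈-subsets⁻ S T k e′∈ = cong suc size , λ { (there x∈) (there x∈T) → dis x∈ x∈T }
∈-subsets⁻ (outside ∷ S) (inside ∷ T) k e∈ with e′ , e′∈ , refl ← ∈-map⁻ (outside ∷_) {xs = subsets S T k} e∈
  with size , dis ← ∈-subsets⁻ S T k e′∈ = size , λ { (there x∈) (there x∈T) → dis x∈ x∈T }
∈-subsets⁻ (outside ∷ S) (outside ∷ T) zero e∈ with e′ , e′∈ , refl ← ∈-map⁻ (outside ∷_) {xs = subsets S T zero} e∈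
  with size , dis ← ∈-subsets⁻ S T zero e′∈ = size , λ { (there x∈) (there x∈T) → dis x∈ x∈T }
∈-subsets⁻ (outside ∷ S) (outside ∷ T) (suc k) e∈ with ∈-++⁻ (map (outside ∷_) (subsets S T (suc k))) e∈
... | inj₁ e∈₁ with e′ , e′∈ , refl ← ∈-map⁻ (outside ∷_) {xs = subsets S T (suc k)} e∈₁
  with size , dis ← ∈-subsets⁻ S T (suc k) e′∈ = size , λ { (there x∈) (there x∈T) → dis x∈ x∈T }
∈-subsets⁻ (outside ∷ S) (outside ∷ T) (suc k) e∈ | inj₂ e∈₂
  with e′ , e′∈ , refl ← ∈-map⁻ (inside ∷_) {xs = subsets S T k} e∈₂
  with size , dis ← ∈-subsets⁻ S T k e′∈ = cong suc size , λ { (there x∈) (there x∈T) → dis x∈ x∈T }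

subsets-unique : ∀ {n} (S T : Subset n) k → Unique (subsets S T k)
subsets-unique []            []            zero    = [] ∷ []
subsets-unique []            []            (suc k) = []
subsets-unique (inside ∷ S)  (inside ∷ T)  k       = []
subsets-unique (inside ∷ S)  (outside ∷ T) zero    = []
subsets-unique (inside ∷ S)  (outside ∷ T) (suc k) = Unique.map⁺ ∷-injectiveʳ (subsets-unique S T k)
subsets-unique (outside ∷ S) (inside ∷ T)  k       = Unique.map⁺ ∷-injectiveʳ (subsets-unique S T k)
subsets-unique (outside ∷ S) (outside ∷ T) zero    = Unique.map⁺ ∷-injectiveʳ (subsets-unique S T zero)
subsets-unique (outside ∷ S) (outside ∷ T) (suc k) =
  Unique.++⁺ (Unique.map⁺ ∷-injectiveʳ (subsets-unique S T (suc k))) (Unique.map⁺ ∷-injectiveʳ (subsets-unique S T k)) heads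
  where
  heads : ∀ {e} → ¬ (e LM.∈ map (outside ∷_) (subsets S T (suc k)) × e LM.∈ map (inside ∷_) (subsets S T k))
  heads (e∈₁ , e∈₂) with _ , _ , refl ← ∈-map⁻ (outside ∷_) {xs = subsets S T (suc k)} e∈₁
    with _ , _ , () ← ∈-map⁻ (inside ∷_) {xs = subsets S T k} e∈₂

-- All such sets occur in `subsets S T k`, whose length is known. It is used with `T = ⊥` to bound
-- degrees, and with `T` the heavy clique to count edges that miss it.
count-bound : ∀ {n} (S T : Subset n) k {xs : List (Subset n)} → Unique xs → Disjoint S T →
  (∀ {e} → e LM.∈ xs → ∣ e ∣ ≡ k × S ⊆ e × Disjoint e T) →
  length xs ≤ extensions (n ∸ ∣ T ∣ ∸ ∣ S ∣) k ∣ S ∣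
count-bound S T k {xs} u dis adm = ≤-trans (unique-⊆⇒length-≤ u member) (≤-reflexive (length-subsets S T k dis))
  where
  member : ∀ {e} → e LM.∈ xs → e LM.∈ subsets S T k
  member {e} e∈ with refl , S⊆e , e∥T ← adm e∈ = ∈-subsets⁺ e S⊆e e∥T

-- Families of k-sets meeting a fixed set

Meets? : ∀ {n} (A : Subset n) → Decidable (λ e → Nonempty (e ∩ A))
Meets? A e = nonempty? (e ∩ A)

length-subsets-⊥ : ∀ {n} (T : Subset n) k → length (subsets ⊥ T k) ≡ (n ∸ ∣ T ∣) C k
length-subsets-⊥ {n} T k = trans (length-subsets ⊥ T k (λ x∈⊥ → contradiction x∈⊥ ∉⊥))
  (cong (λ z → extensions (n ∸ ∣ T ∣ ∸ z) k z) (∣⊥∣≡0 n))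

length-subsets-⊥⊥ : ∀ n k → length (subsets {n} ⊥ ⊥ k) ≡ n C k
length-subsets-⊥⊥ n k = trans (length-subsets-⊥ {n} ⊥ k) (cong (λ z → (n ∸ z) C k) (∣⊥∣≡0 n))

uniform-bound : ∀ {n k} (H : Hypergraph n) → UniformHG k H → length H ≤ n C k
uniform-bound {n} {k} H (unique , sizes) = ≤-trans (unique-⊆⇒length-≤ unique member) (≤-reflexive (length-subsets-⊥⊥ n k))
  where
  member : ∀ {e} → e LM.∈ H → e LM.∈ subsets ⊥ ⊥ k
  member {e} e∈ with refl ← All.lookup sizes e∈ = ∈-subsets⁺ e (λ x∈⊥ → contradiction x∈⊥ ∉⊥) (λ _ → ∉⊥)

-- Appending every `k`-set that avoids `A` keeps the list uniform and free of duplicates, so the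
-- total is still at most `n C k`.
meeting-upper : ∀ {n k} (A : Subset n) (H : Hypergraph n) → UniformHG k H →
  length (filter (Meets? A) H) + (n ∸ ∣ A ∣) C k ≤ n C k
meeting-upper {n} {k} A H (unique , sizes) = begin
  length xs + (n ∸ ∣ A ∣) C k    ≡⟨ cong (length xs +_) (length-subsets-⊥ A k) ⟨
  length xs + length ys          ≡⟨ length-++ xs ⟨
  length (xs ++ ys)              ≤⟨ uniform-bound (xs ++ ys) (Unique.++⁺ (Unique.filter⁺ (Meets? A) unique) (subsets-unique ⊥ A k) apart , All.tabulate size) ⟩
  n C k                          ∎
  where
  open ≤-Reasoning
  xs = filter (Meets? A) H
  ys = subsets ⊥ A k
  apart : ∀ {e} → ¬ (e LM.∈ xs × e LM.∈ ys)
  apart {e} (e∈xs , e∈ys) with x , x∈ ← proj₂ (∈-filter⁻ (Meets? A) {xs = H} e∈xs)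
    with x∈e , x∈A ← x∈p∩q⁻ e A x∈ = proj₂ (∈-subsets⁻ ⊥ A k e∈ys) x∈e x∈A
  size : ∀ {e} → e LM.∈ xs ++ ys → ∣ e ∣ ≡ k
  size e∈ with ∈-++⁻ xs e∈
  ... | inj₁ e∈xs = All.lookup sizes (proj₁ (∈-filter⁻ (Meets? A) {xs = H} e∈xs))
  ... | inj₂ e∈ys = proj₁ (∈-subsets⁻ ⊥ A k e∈ys)

-- For `A` a maximum clique this is the competitor that a family of maximum cardinality has to
-- match.
meeting : ∀ {n} → Subset n → ℕ → Hypergraph n
meeting A k = filter (Meets? A) (subsets ⊥ ⊥ k)

meeting-uniform : ∀ {n} (A : Subset n) k → UniformHG k (meeting A k)
meeting-uniform A k = Unique.filter⁺ (Meets? A) (subsets-unique ⊥ ⊥ k) ,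
  All.tabulate (λ e∈ → proj₁ (∈-subsets⁻ ⊥ ⊥ k (proj₁ (∈-filter⁻ (Meets? A) e∈))))

length-meeting : ∀ {n} (A : Subset n) k → n C k ≤ length (meeting A k) + (n ∸ ∣ A ∣) C k
length-meeting {n} A k = begin
  n C k                                        ≡⟨ length-subsets-⊥⊥ n k ⟨
  length all                                   ≡⟨ length-filter-split (Meets? A) all ⟨
  length (meeting A k) + length avoiding       ≤⟨ +-monoʳ-≤ (length (meeting A k)) (≤-trans (unique-⊆⇒length-≤ (Unique.filter⁺ (¬? ∘ Meets? A) (subsets-unique ⊥ ⊥ k)) member) (≤-reflexive (length-subsets-⊥ A k))) ⟩
  length (meeting A k) + (n ∸ ∣ A ∣) C k       ∎
  where
  open ≤-Reasoning
  all = subsets ⊥ ⊥ k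
  avoiding = filter (¬? ∘ Meets? A) all
  member : ∀ {e} → e LM.∈ avoiding → e LM.∈ subsets ⊥ A k
  member {e} e∈ with e∈all , misses ← ∈-filter⁻ (¬? ∘ Meets? A) {xs = all} e∈
    with refl , _ ← ∈-subsets⁻ ⊥ ⊥ k e∈all =
    ∈-subsets⁺ e (λ x∈⊥ → contradiction x∈⊥ ∉⊥) (λ x∈e x∈A → misses (_ , x∈p∩q⁺ (x∈e , x∈A)))

-- Cardinalities of subsets

∣p∪q∣≤∣p∣+∣q∣ : ∀ {n} (p q : Subset n) → ∣ p ∪ q ∣ ≤ ∣ p ∣ + ∣ q ∣
∣p∪q∣≤∣p∣+∣q∣ [] [] = z≤n
∣p∪q∣≤∣p∣+∣q∣ (inside ∷ p)  (inside ∷ q)  = s≤s (≤-trans (∣p∪q∣≤∣p∣+∣q∣ p q) (+-monoʳ-≤ (∣ p ∣) (n≤1+n (∣ q ∣))))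
∣p∪q∣≤∣p∣+∣q∣ (inside ∷ p)  (outside ∷ q) = s≤s (∣p∪q∣≤∣p∣+∣q∣ p q)
∣p∪q∣≤∣p∣+∣q∣ (outside ∷ p) (inside ∷ q)  = ≤-trans (s≤s (∣p∪q∣≤∣p∣+∣q∣ p q)) (≤-reflexive (sym (+-suc (∣ p ∣) (∣ q ∣))))
∣p∪q∣≤∣p∣+∣q∣ (outside ∷ p) (outside ∷ q) = ∣p∪q∣≤∣p∣+∣q∣ p q

∣p─q∣+∣p∩q∣≡∣p∣ : ∀ {n} (p q : Subset n) → ∣ p ─ q ∣ + ∣ p ∩ q ∣ ≡ ∣ p ∣
∣p─q∣+∣p∩q∣≡∣p∣ [] [] = refl
∣p─q∣+∣p∩q∣≡∣p∣ (inside ∷ p)  (inside ∷ q)  = trans (+-suc _ _) (cong suc (∣p─q∣+∣p∩q∣≡∣p∣ p q))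
∣p─q∣+∣p∩q∣≡∣p∣ (inside ∷ p)  (outside ∷ q) = cong suc (∣p─q∣+∣p∩q∣≡∣p∣ p q)
∣p─q∣+∣p∩q∣≡∣p∣ (outside ∷ p) (inside ∷ q)  = ∣p─q∣+∣p∩q∣≡∣p∣ p q
∣p─q∣+∣p∩q∣≡∣p∣ (outside ∷ p) (outside ∷ q) = ∣p─q∣+∣p∩q∣≡∣p∣ p q

x∈p─q⇒x∉q : ∀ {n} (p q : Subset n) {x} → x ∈ p ─ q → x ∉ q
x∈p─q⇒x∉q (s ∷ p) (outside ∷ q) (there x∈) (there x∈q) = x∈p─q⇒x∉q p q x∈ x∈q
x∈p─q⇒x∉q (s ∷ p) (inside ∷ q)  (there x∈) (there x∈q) = x∈p─q⇒x∉q p q x∈ x∈q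

∣p∪⁅x⁆∣≡1+∣p∣ : ∀ {n} (p : Subset n) {x} → x ∉ p → ∣ p ∪ ⁅ x ⁆ ∣ ≡ suc ∣ p ∣
∣p∪⁅x⁆∣≡1+∣p∣ p {x} x∉p = begin
  ∣ p ∪ ⁅ x ⁆ ∣        ≡⟨ ∣p∪q∣≡∣p∣+∣q∣ p ⁅ x ⁆ (λ y∈p y∈⁅x⁆ → x∉p (subst (_∈ p) (x∈⁅y⁆⇒x≡y x y∈⁅x⁆) y∈p)) ⟩
  ∣ p ∣ + ∣ ⁅ x ⁆ ∣    ≡⟨ cong (∣ p ∣ +_) (∣⁅x⁆∣≡1 x) ⟩
  ∣ p ∣ + 1            ≡⟨ +-comm (∣ p ∣) 1 ⟩
  suc ∣ p ∣            ∎
  where open ≡-Reasoning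

∣⋃∣-bound : ∀ {m n} (I : Subset m) (N : Fin m → Subset n) (b : ℕ) (W : Subset n) →
  (∀ {w} → w ∈ W → ∃ λ i → i ∈ I × w ∈ N i) → (∀ {i} → i ∈ I → ∣ N i ∣ ≤ b) → ∣ W ∣ ≤ ∣ I ∣ * b
∣⋃∣-bound {n = n} [] N b W cover small = ≤-trans (p⊆q⇒∣p∣≤∣q∣ W⊆⊥) (≤-reflexive (∣⊥∣≡0 n))
  where
  W⊆⊥ : W ⊆ ⊥
  W⊆⊥ w∈ with () , _ ← cover w∈
∣⋃∣-bound (outside ∷ I) N b W cover small = ∣⋃∣-bound I (N ∘ suc) b W cover′ (small ∘ there)
  where
  cover′ : ∀ {w} → w ∈ W → ∃ λ i → i ∈ I × w ∈ N (suc i)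
  cover′ w∈ with suc i , there i∈ , w∈N ← cover w∈ = i , i∈ , w∈N
∣⋃∣-bound (inside ∷ I) N b W cover small = begin
  ∣ W ∣                              ≡⟨ ∣p─q∣+∣p∩q∣≡∣p∣ W (N zero) ⟨
  ∣ W ─ N zero ∣ + ∣ W ∩ N zero ∣    ≤⟨ +-mono-≤ (∣⋃∣-bound I (N ∘ suc) b (W ─ N zero) cover′ (small ∘ there)) (≤-trans (∣p∩q∣≤∣q∣ W (N zero)) (small here)) ⟩
  ∣ I ∣ * b + b                      ≡⟨ +-comm (∣ I ∣ * b) b ⟩
  b + ∣ I ∣ * b                      ∎
  where
  open ≤-Reasoning
  cover′ : ∀ {w} → w ∈ W ─ N zero → ∃ λ i → i ∈ I × w ∈ N (suc i)
  cover′ w∈ with cover (p─q⊆p W (N zero) w∈)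
  ... | zero  , _        , w∈N = contradiction w∈N (x∈p─q⇒x∉q W (N zero) w∈)
  ... | suc i , there i∈ , w∈N = i , i∈ , w∈N

x∈p⇒0<∣p∣ : ∀ {n} {p : Subset n} {x} → x ∈ p → 0 < ∣ p ∣
x∈p⇒0<∣p∣ {p = p} {x} x∈p = subst (_≤ ∣ p ∣) (∣⁅x⁆∣≡1 x)
  (p⊆q⇒∣p∣≤∣q∣ (λ y∈ → subst (_∈ p) (sym (x∈⁅y⁆⇒x≡y x y∈)) x∈p))

0<∣p∣⇒Nonempty : ∀ {n} (p : Subset n) → 0 < ∣ p ∣ → Nonempty p
0<∣p∣⇒Nonempty {n} p 0<∣p∣ with nonempty? p
... | yes ne = ne
... | no ¬ne = contradiction 0<∣p∣ (≤⇒≯ (≤-trans (p⊆q⇒∣p∣≤∣q∣ {q = ⊥} (λ x∈p → contradiction (_ , x∈p) ¬ne)) (≤-reflexive (∣⊥∣≡0 n))))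

comprehension : ∀ {n} {P : Pred (Fin n) 0ℓ} → Decidable P → Subset n
comprehension P? = tabulate (does ∘ P?)

module _ {n} {P : Pred (Fin n) 0ℓ} (P? : Decidable P) where

  ∈-comprehension⁺ : ∀ {x} → P x → x ∈ comprehension P?
  ∈-comprehension⁺ {x} px = lookup⇒[]= x _ (trans (lookup∘tabulate _ x) (dec-true (P? x) px))

  ∈-comprehension⁻ : ∀ {x} → x ∈ comprehension P? → P x
  ∈-comprehension⁻ {x} x∈ with P? x | trans (sym (lookup∘tabulate (does ∘ P?) x)) ([]=⇒lookup x∈)
  ... | yes px | _ = px

least : ∀ {P : Pred ℕ 0ℓ} → Decidable P → ∀ m → P m → ∃ λ s → P s × (∀ {j} → j < s → ¬ P j)
least P? zero    pm = zero , pm , λ ()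
least P? (suc m) pm with P? zero
... | yes p0 = zero , p0 , λ ()
... | no ¬p0 with s , ps , below ← least (P? ∘ suc) m pm = suc s , ps , λ { {zero} _ → ¬p0 ; {suc j} (s≤s j<s) → below j<s }

-- Closed neighbourhoods and covers

module Touching {n : ℕ} (G : Graph n) where

  N[_] : Fin n → Subset n
  N[ v ] = ⁅ v ⁆ ∪ neighbourhood G v

  ∈-neighbourhood⁺ : ∀ {v w} → Adjacent G v w → w ∈ neighbourhood G v
  ∈-neighbourhood⁺ {v} {w} vw = lookup⇒[]= w _ (trans (lookup∘tabulate (adj G v) w) vw)

  ∈-neighbourhood⁻ : ∀ {v w} → w ∈ neighbourhood G v → Adjacent G v w
  ∈-neighbourhood⁻ {v} {w} w∈ = trans (sym (lookup∘tabulate (adj G v) w)) ([]=⇒lookup w∈)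

  ∈-N⁻ : ∀ {v w} → w ∈ N[ v ] → w ≡ v ⊎ Adjacent G v w
  ∈-N⁻ {v} w∈ with x∈p∪q⁻ ⁅ v ⁆ (neighbourhood G v) w∈
  ... | inj₁ w∈⁅v⁆ = inj₁ (x∈⁅y⁆⇒x≡y v w∈⁅v⁆)
  ... | inj₂ w∈Nv  = inj₂ (∈-neighbourhood⁻ w∈Nv)

  ∈-N-refl : ∀ {v} → v ∈ N[ v ]
  ∈-N-refl {v} = x∈p∪q⁺ (inj₁ (x∈⁅x⁆ v))

  ∈-N-adj : ∀ {v w} → Adjacent G v w → w ∈ N[ v ]
  ∈-N-adj vw = x∈p∪q⁺ (inj₂ (∈-neighbourhood⁺ vw))

  ∈-N-sym : ∀ {v w} → w ∈ N[ v ] → v ∈ N[ w ]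
  ∈-N-sym {v} {w} w∈ with ∈-N⁻ w∈
  ... | inj₁ refl = ∈-N-refl
  ... | inj₂ vw   = ∈-N-adj (trans (Graph.sym G w v) vw)

  -- Closed neighbourhoods merge the two alternatives of `GIntersecting`, a common vertex or an edge
  -- of `G`, into one relation. It is also applied to sets that are not edges of the hypergraph,
  -- such as covers.
  Touches : Subset n → Subset n → Set
  Touches S f = ∃ λ v → v ∈ S × Nonempty (f ∩ N[ v ])

  Touches? : ∀ S → Decidable (Touches S)
  Touches? S f = any? (λ v → v ∈? S ×-dec nonempty? (f ∩ N[ v ]))

  touches : ∀ {S f v w} → v ∈ S → w ∈ f → w ∈ N[ v ] → Touches S f
  touches v∈ w∈ w∈N = _ , v∈ , _ , x∈p∩q⁺ (w∈ , w∈N)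

  touches⁻ : ∀ {S f} → Touches S f → ∃ λ v → ∃ λ w → v ∈ S × w ∈ f × w ∈ N[ v ]
  touches⁻ {f = f} (v , v∈ , w , w∈) with w∈f , w∈N ← x∈p∩q⁻ f N[ v ] w∈ = v , w , v∈ , w∈f , w∈N

  intersecting⇒touches : ∀ {H} → GIntersecting G H → ∀ {e f} → e LM.∈ H → f LM.∈ H → Touches e f
  intersecting⇒touches int {e} {f} e∈ f∈ with int e f e∈ f∈
  ... | inj₁ (x , x∈) with x∈e , x∈f ← x∈p∩q⁻ e f x∈ = touches x∈e x∈f ∈-N-refl
  ... | inj₂ (v , w , v∈ , w∈ , vw) = touches v∈ w∈ (∈-N-adj vw)

  touches⇒intersecting : ∀ {H} → (∀ {e f} → e LM.∈ H → f LM.∈ H → Touches e f) → GIntersecting G H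
  touches⇒intersecting t e f e∈ f∈ with v , w , v∈ , w∈ , w∈N ← touches⁻ (t e∈ f∈) with ∈-N⁻ w∈N
  ... | inj₁ refl = inj₁ (v , x∈p∩q⁺ (v∈ , w∈))
  ... | inj₂ vw   = inj₂ (v , w , v∈ , w∈ , vw)

  touches-sym : ∀ {S f} → Touches S f → Touches f S
  touches-sym t with v , w , v∈ , w∈ , w∈N ← touches⁻ t = touches w∈ v∈ (∈-N-sym w∈N)

  clique-touches : ∀ {K} → IsClique G K → ∀ {e f} → Nonempty (e ∩ K) → Nonempty (f ∩ K) → Touches e f
  clique-touches {K} clique {e} {f} (v , v∈) (w , w∈)
    with v∈e , v∈K ← x∈p∩q⁻ e K v∈ | w∈f , w∈K ← x∈p∩q⁻ f K w∈ with v ≟F w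
  ... | yes refl = touches v∈e w∈f ∈-N-refl
  ... | no v≢w   = touches v∈e w∈f (∈-N-adj (clique v w v∈K w∈K v≢w))

  singleton-clique : ∀ u → IsClique G ⁅ u ⁆
  singleton-clique u v w v∈ w∈ v≢w = contradiction (trans (x∈⁅y⁆⇒x≡y u v∈) (sym (x∈⁅y⁆⇒x≡y u w∈))) v≢w

  clique-extend : ∀ {K w} → IsClique G K → (∀ {v} → v ∈ K → Adjacent G v w) → IsClique G (K ∪ ⁅ w ⁆)
  clique-extend {K} {w} clique joined u v u∈ v∈ u≢v with x∈p∪q⁻ K ⁅ w ⁆ u∈ | x∈p∪q⁻ K ⁅ w ⁆ v∈
  ... | inj₁ u∈K | inj₁ v∈K = clique u v u∈K v∈K u≢v
  ... | inj₁ u∈K | inj₂ v∈w = subst (Adjacent G u) (sym (x∈⁅y⁆⇒x≡y w v∈w)) (joined u∈K)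
  ... | inj₂ u∈w | inj₁ v∈K = trans (Graph.sym G u v) (subst (Adjacent G v) (sym (x∈⁅y⁆⇒x≡y w u∈w)) (joined v∈K))
  ... | inj₂ u∈w | inj₂ v∈w = singleton-clique w u v u∈w v∈w u≢v

  meeting-intersecting : ∀ {K} → IsClique G K → ∀ k → GIntersecting G (meeting K k)
  meeting-intersecting {K} clique k = touches⇒intersecting (λ e∈ f∈ → clique-touches clique (meets e∈) (meets f∈))
    where
    meets : ∀ {e} → e LM.∈ meeting K k → Nonempty (e ∩ K)
    meets e∈ = proj₂ (∈-filter⁻ (Meets? K) {xs = subsets ⊥ ⊥ k} e∈)

  module _ {Δ : ℕ} (degree≤Δ : ∀ v → degree G v ≤ Δ) where

    ∣N∣≤1+Δ : ∀ v → ∣ N[ v ] ∣ ≤ suc Δ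
    ∣N∣≤1+Δ v = ≤-trans (∣p∪q∣≤∣p∣+∣q∣ ⁅ v ⁆ (neighbourhood G v)) (+-mono-≤ (≤-reflexive (∣⁅x⁆∣≡1 v)) (degree≤Δ v))

    -- Two nested union bounds: first over `v` in `S`, then over the at most `suc Δ` vertices of
    -- `N[ v ]`.
    touching-bound : ∀ c b S (xs : List (Subset n)) → (∀ {e} → e LM.∈ xs → Touches S e) →
      (∀ {v w} → v ∈ S → w ∈ N[ v ] → c * length (filter (w ∈?_) xs) ≤ b) →
      c * length xs ≤ ∣ S ∣ * (suc Δ * b)
    touching-bound c b S xs touch small =
      union-bound (λ v e → nonempty? (e ∩ N[ v ])) c (suc Δ * b) S xs touch near
      where
      near : ∀ {v} → v ∈ S → c * length (filter (λ e → nonempty? (e ∩ N[ v ])) xs) ≤ suc Δ * b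
      near {v} v∈S = ≤-trans
        (union-bound (λ w e → w ∈? e) c b N[ v ] (filter near? xs) meets
          (λ {w} w∈N → ≤-trans (*-monoʳ-≤ c (length-filter-filter-≤ near? (w ∈?_) xs)) (small v∈S w∈N)))
        (*-monoˡ-≤ b (∣N∣≤1+Δ v))
        where
        near? : Decidable (λ e → Nonempty (e ∩ N[ v ]))
        near? e = nonempty? (e ∩ N[ v ])
        meets : ∀ {e} → e LM.∈ filter near? xs → ∃ λ w → w ∈ N[ v ] × w ∈ e
        meets {e} e∈ with w , w∈ ← proj₂ (∈-filter⁻ near? {xs = xs} e∈)
          with w∈e , w∈N ← x∈p∩q⁻ e N[ v ] w∈ = w , w∈N , w∈e

    -- Every vertex of `K` other than `v` already takes up a neighbour of `v`. This yields the
    -- factor `Δ + 1 ∸ ω` of the bound, and also `ω ≤ suc Δ`.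
    outer-neighbours : ∀ {K v} → IsClique G K → v ∈ K → ∣ neighbourhood G v ─ K ∣ + ∣ K ∣ ≤ suc Δ
    outer-neighbours {K} {v} clique v∈K = begin
      ∣ Nv ─ K ∣ + ∣ K ∣                        ≤⟨ +-monoʳ-≤ (∣ Nv ─ K ∣) (≤-trans (p⊆q⇒∣p∣≤∣q∣ K⊆) (∣p∪q∣≤∣p∣+∣q∣ ⁅ v ⁆ (Nv ∩ K))) ⟩
      ∣ Nv ─ K ∣ + (∣ ⁅ v ⁆ ∣ + ∣ Nv ∩ K ∣)     ≡⟨ cong (λ z → ∣ Nv ─ K ∣ + (z + ∣ Nv ∩ K ∣)) (∣⁅x⁆∣≡1 v) ⟩
      ∣ Nv ─ K ∣ + suc ∣ Nv ∩ K ∣               ≡⟨ +-suc (∣ Nv ─ K ∣) (∣ Nv ∩ K ∣) ⟩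
      suc (∣ Nv ─ K ∣ + ∣ Nv ∩ K ∣)             ≡⟨ cong suc (∣p─q∣+∣p∩q∣≡∣p∣ Nv K) ⟩
      suc ∣ Nv ∣                                ≤⟨ s≤s (degree≤Δ v) ⟩
      suc Δ                                     ∎
      where
      open ≤-Reasoning
      Nv = neighbourhood G v
      K⊆ : K ⊆ ⁅ v ⁆ ∪ (Nv ∩ K)
      K⊆ {u} u∈K with v ≟F u
      ... | yes refl = x∈p∪q⁺ (inj₁ (x∈⁅x⁆ v))
      ... | no v≢u   = x∈p∪q⁺ (inj₂ (x∈p∩q⁺ (∈-neighbourhood⁺ (clique v u v∈K u∈K v≢u) , u∈K)))

-- Vertices of large degree

module Family
  {n : ℕ} (G : Graph n) {Δ : ℕ} (degree≤Δ : ∀ v → degree G v ≤ Δ)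
  {k′ : ℕ} (large : 4 * suc Δ * suc Δ * (suc k′ * suc k′) ≤ n)
  (H : Hypergraph n) (uniform : UniformHG (suc k′) H) (intersecting : GIntersecting G H)
  where

  open Touching G

  k d M : ℕ
  k = suc k′
  d = suc Δ
  M = 4 * d

  1≤k : 1 ≤ k
  1≤k = s≤s z≤n

  -- The number of k-sets through a given j-set.
  β : ℕ → ℕ
  β j = extensions (n ∸ j) k j

  k≤n : k ≤ n
  k≤n = ≤-trans (m≤n*m k (M * d * k)) (≤-trans (≤-reflexive (*-assoc (M * d) k k)) large)

  -- By `extensions-ratio`, passing from `j` to `suc j` shrinks `β` at least by the factor `n / k`.
  -- The hypothesis `large` says that this pays for a branching into `k * d` cases and leaves the
  -- factor `M`.
  β-decay : ∀ j → M * (k * (d * β (suc j))) ≤ β j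
  β-decay j = *-cancelˡ-≤ k (begin
    k * (M * (k * (d * β (suc j))))     ≡⟨ regroup k M d (β (suc j)) ⟩
    M * d * (k * k) * β (suc j)         ≤⟨ *-monoˡ-≤ (β (suc j)) large ⟩
    n * β (suc j)                       ≤⟨ extensions-ratio n k j k≤n ⟩
    k * β j                             ∎)
    where
    open ≤-Reasoning
    regroup : ∀ k m d b → k * (m * (k * (d * b))) ≡ m * d * (k * k) * b
    regroup = solve-∀

  size : ∀ {e} → e LM.∈ H → ∣ e ∣ ≡ k
  size = All.lookup (proj₂ uniform)

  -- Degrees of sets and branching over uncovered sets

  deg : Subset n → ℕ
  deg S = length (filter (S ⊆?_) H)

  deg≤β : ∀ S → deg S ≤ β ∣ S ∣
  deg≤β S = ≤-trans
    (count-bound S ⊥ k (Unique.filter⁺ (S ⊆?_) (proj₁ uniform)) (λ _ → ∉⊥)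
      (λ e∈ → let e∈H , S⊆e = ∈-filter⁻ (S ⊆?_) {xs = H} e∈ in size e∈H , (λ {x} → S⊆e {x}) , λ _ → ∉⊥))
    (≤-reflexive (cong (λ z → extensions (n ∸ z ∸ ∣ S ∣) k (∣ S ∣)) (∣⊥∣≡0 n)))

  Cover : Subset n → Set
  Cover S = All (Touches S) H

  Cover? : Decidable Cover
  Cover? S = All.all? (Touches? S) H

  missed-edge : ∀ {S} → ¬ Cover S → ∃ λ f → f LM.∈ H × ¬ Touches S f
  missed-edge {S} = LM.find ∘ ¬All⇒Any¬ (Touches? S) H

  -- Each edge through `S` contains a vertex `w` of the closed neighbourhood of `f`, and `apart`
  -- makes `w` new to `S`, so the edge is counted in the degree of a strictly larger set. Here `f`
  -- is either a missed edge or a single vertex that is a cover.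
  extend : ∀ c b S f → (∀ {e} → e LM.∈ H → S ⊆ e → Touches f e) → ¬ Touches f S →
    (∀ {w} → w ∉ S → c * deg (S ∪ ⁅ w ⁆) ≤ b) → c * deg S ≤ ∣ f ∣ * (d * b)
  extend c b S f touch apart small = touching-bound degree≤Δ c b f (filter (S ⊆?_) H)
    (λ e∈ → let e∈H , S⊆e = ∈-filter⁻ (S ⊆?_) {xs = H} e∈ in touch e∈H (λ {x} → S⊆e {x}))
    (λ {v} {w} v∈f w∈N → ≤-trans
      (*-monoʳ-≤ c (length-filter-filter (S ⊆?_) (w ∈?_) (S ∪ ⁅ w ⁆ ⊆?_) add H))
      (small (λ w∈S → apart (touches v∈f w∈S w∈N))))
    where
    add : ∀ {w e} → S ⊆ e → w ∈ e → S ∪ ⁅ w ⁆ ⊆ e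
    add {w} S⊆e w∈e x∈ with x∈p∪q⁻ S ⁅ w ⁆ x∈
    ... | inj₁ x∈S = S⊆e x∈S
    ... | inj₂ x∈w = subst (_∈ _) (sym (x∈⁅y⁆⇒x≡y w x∈w)) w∈e

  extend-uncovered : ∀ c b S → ¬ Cover S → (∀ {w} → w ∉ S → c * deg (S ∪ ⁅ w ⁆) ≤ b) → c * deg S ≤ k * (d * b)
  extend-uncovered c b S ¬cover small with f , f∈H , apart ← missed-edge ¬cover =
    subst (λ z → c * deg S ≤ z * (d * b)) (size f∈H)
      (extend c b S f (λ e∈H _ → intersecting⇒touches intersecting f∈H e∈H) (apart ∘ touches-sym) small)

  -- Induction on the number `i` of vertices that `S` lacks to reach size `s`. At size `s` only the
  -- trivial bound is available; below it `S` is uncovered, so one branching step applies and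
  -- `β-decay` turns it into a gain of `M`.
  deg-decay : ∀ s → (∀ {S} → ∣ S ∣ < s → ¬ Cover S) → ∀ i S → ∣ S ∣ + i ≡ s → M ^ i * deg S ≤ β ∣ S ∣
  deg-decay s small-uncovered zero S _ = ≤-trans (≤-reflexive (*-identityˡ (deg S))) (deg≤β S)
  deg-decay s small-uncovered (suc i) S eq = begin
    M ^ suc i * deg S                       ≡⟨ *-assoc M (M ^ i) (deg S) ⟩
    M * (M ^ i * deg S)                     ≤⟨ *-monoʳ-≤ M (extend-uncovered (M ^ i) (β (suc ∣ S ∣)) S (small-uncovered ∣S∣<s) next) ⟩
    M * (k * (d * β (suc ∣ S ∣)))           ≤⟨ β-decay (∣ S ∣) ⟩
    β ∣ S ∣                                 ∎
    where
    open ≤-Reasoning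
    ∣S∣<s : ∣ S ∣ < s
    ∣S∣<s = subst (∣ S ∣ <_) eq (m<m+n (∣ S ∣) z<s)
    next : ∀ {w} → w ∉ S → M ^ i * deg (S ∪ ⁅ w ⁆) ≤ β (suc ∣ S ∣)
    next {w} w∉S = subst (λ z → M ^ i * deg (S ∪ ⁅ w ⁆) ≤ β z) (∣p∪⁅x⁆∣≡1+∣p∣ S w∉S)
      (deg-decay s small-uncovered i (S ∪ ⁅ w ⁆)
        (trans (cong (_+ i) (∣p∪⁅x⁆∣≡1+∣p∣ S w∉S)) (trans (sym (+-suc (∣ S ∣) i)) eq)))

  -- The clique of heavy vertices

  Heavy : Fin n → Set
  Heavy u = β 1 < M * deg ⁅ u ⁆

  Heavy? : Decidable Heavy
  Heavy? u = β 1 <? M * deg ⁅ u ⁆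

  K : Subset n
  K = comprehension Heavy?

  deg-pair≤β2 : ∀ u {w} → w ∉ ⁅ u ⁆ → 1 * deg (⁅ u ⁆ ∪ ⁅ w ⁆) ≤ β 2
  deg-pair≤β2 u {w} w∉ = ≤-trans (≤-reflexive (*-identityˡ _))
    (≤-trans (deg≤β (⁅ u ⁆ ∪ ⁅ w ⁆))
      (≤-reflexive (cong β (trans (∣p∪⁅x⁆∣≡1+∣p∣ ⁅ u ⁆ w∉) (cong suc (∣⁅x⁆∣≡1 u))))))

  -- One branching step bounds the degree of an uncovered vertex by `k * (d * β 2)`, which is at
  -- most `β 1 / M`. The threshold in `Heavy` is chosen to be exactly this last value.
  heavy⇒cover : ∀ {u} → Heavy u → Cover ⁅ u ⁆
  heavy⇒cover {u} heavy with Cover? ⁅ u ⁆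
  ... | yes cover = cover
  ... | no ¬cover = contradiction heavy (≤⇒≯ (≤-trans
    (*-monoʳ-≤ M (subst (_≤ k * (d * β 2)) (*-identityˡ (deg ⁅ u ⁆)) (extend-uncovered 1 (β 2) ⁅ u ⁆ ¬cover (deg-pair≤β2 u))))
    (β-decay 1)))

  -- If `u` and `v` were not adjacent, the cover `⁅ v ⁆` could replace the missed edge when
  -- branching from `⁅ u ⁆`. It has `1 ≤ k` vertices, so the degree of `u` would again stay below
  -- the threshold.
  heavy-adjacent : ∀ {u v} → u ≢ v → Heavy u → Heavy v → Adjacent G u v
  heavy-adjacent {u} {v} u≢v hu hv with adj G u v ≟B true
  ... | yes uv = uv
  ... | no ¬uv = contradiction hu (≤⇒≯ (begin
    M * deg ⁅ u ⁆                 ≡⟨ cong (M *_) (*-identityˡ (deg ⁅ u ⁆)) ⟨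
    M * (1 * deg ⁅ u ⁆)           ≤⟨ *-monoʳ-≤ M (extend 1 (β 2) ⁅ u ⁆ ⁅ v ⁆ (λ e∈H _ → All.lookup (heavy⇒cover hv) e∈H) apart (deg-pair≤β2 u)) ⟩
    M * (∣ ⁅ v ⁆ ∣ * (d * β 2))   ≡⟨ cong (λ z → M * (z * (d * β 2))) (∣⁅x⁆∣≡1 v) ⟩
    M * (1 * (d * β 2))           ≤⟨ *-monoʳ-≤ M (*-monoˡ-≤ (d * β 2) 1≤k) ⟩
    M * (k * (d * β 2))           ≤⟨ β-decay 1 ⟩
    β 1                           ∎))
    where
    open ≤-Reasoning
    apart : ¬ Touches ⁅ v ⁆ ⁅ u ⁆
    apart t with x , y , x∈ , y∈ , y∈N ← touches⁻ t
      with refl ← x∈⁅y⁆⇒x≡y v x∈ | refl ← x∈⁅y⁆⇒x≡y u y∈ with ∈-N⁻ y∈N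
    ... | inj₁ u≡v = u≢v u≡v
    ... | inj₂ vu  = ¬uv (trans (Graph.sym G u v) vu)

  K-clique : IsClique G K
  K-clique u v u∈K v∈K u≢v = heavy-adjacent u≢v (∈-comprehension⁻ Heavy? u∈K) (∈-comprehension⁻ Heavy? v∈K)

  -- A vertex of `K` in `e` is a cover by itself. Since `e` is arbitrary, this applies to sets about
  -- to be added to `H`.
  K-touches : ∀ {e f} → Nonempty (e ∩ K) → f LM.∈ H → Touches e f
  K-touches {e} {f} (v , v∈) f∈H with v∈e , v∈K ← x∈p∩q⁻ e K v∈
    with x , w , x∈ , w∈f , w∈N ← touches⁻ (All.lookup (heavy⇒cover (∈-comprehension⁻ Heavy? v∈K)) f∈H)
    with refl ← x∈⁅y⁆⇒x≡y v x∈ = touches v∈e w∈f w∈N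

  vertex-degree : ∀ w → length (filter (w ∈?_) H) ≤ deg ⁅ w ⁆
  vertex-degree w = length-filter-mono (w ∈?_) (⁅ w ⁆ ⊆?_)
    (λ {e} w∈e {x} x∈ → subst (_∈ e) (sym (x∈⁅y⁆⇒x≡y w x∈)) w∈e) H

  vertex-filter : ∀ w {P : Pred (Subset n) 0ℓ} (P? : Decidable P) → length (filter (w ∈?_) (filter P? H)) ≤ deg ⁅ w ⁆
  vertex-filter w P? = ≤-trans (length-filter-filter-≤ P? (w ∈?_) H) (vertex-degree w)

  deg-vertex≤β1 : ∀ w → deg ⁅ w ⁆ ≤ β 1
  deg-vertex≤β1 w = subst (λ z → deg ⁅ w ⁆ ≤ β z) (∣⁅x⁆∣≡1 w) (deg≤β ⁅ w ⁆)

  -- Edges meeting and edges missing the heavy clique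

  H-in H-out : Hypergraph n
  H-in  = filter (Meets? K) H
  H-out = filter (¬? ∘ Meets? K) H

  H-in-bound : length H-in ≤ ∣ K ∣ * β 1
  H-in-bound = subst (_≤ ∣ K ∣ * β 1) (*-identityˡ (length H-in))
    (union-bound (λ w e → w ∈? e) 1 (β 1) K H-in meets
      (λ {w} _ → ≤-trans (≤-reflexive (*-identityˡ _)) (≤-trans (vertex-filter w (Meets? K)) (deg-vertex≤β1 w))))
    where
    meets : ∀ {e} → e LM.∈ H-in → ∃ λ w → w ∈ K × w ∈ e
    meets {e} e∈ with w , w∈ ← proj₂ (∈-filter⁻ (Meets? K) {xs = H} e∈)
      with w∈e , w∈K ← x∈p∩q⁻ e K w∈ = w , w∈K , w∈e

  -- The edges touch the single vertex of `S`, so they are spread over at most `d` vertices. Heavy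
  -- ones among these lie in `K` and contribute nothing, light ones at most `β 1 / M` each; since
  -- `M = 4 * d`, the total is at most `β 1 / 4`.
  H-out-bound : ∀ {S} → ∣ S ∣ ≡ 1 → Cover S → 4 * length H-out ≤ β 1
  H-out-bound {S} ∣S∣≡1 cover = *-cancelˡ-≤ d (begin
    d * (4 * length H-out)      ≡⟨ *-assoc d 4 (length H-out) ⟨
    d * 4 * length H-out        ≡⟨ cong (_* length H-out) (*-comm d 4) ⟩
    M * length H-out            ≤⟨ touching-bound degree≤Δ M (β 1) S H-out (All.lookup cover ∘ proj₁ ∘ ∈-filter⁻ (¬? ∘ Meets? K) {xs = H}) light ⟩
    ∣ S ∣ * (d * β 1)           ≡⟨ cong (_* (d * β 1)) ∣S∣≡1 ⟩
    1 * (d * β 1)               ≡⟨ *-identityˡ (d * β 1) ⟩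
    d * β 1                     ∎)
    where
    open ≤-Reasoning
    light : ∀ {v w} → v ∈ S → w ∈ N[ v ] → M * length (filter (w ∈?_) H-out) ≤ β 1
    light {w = w} _ _ with Heavy? w
    ... | no ¬heavy = ≤-trans (*-monoʳ-≤ M (vertex-filter w (¬? ∘ Meets? K))) (≮⇒≥ ¬heavy)
    ... | yes heavy = ≤-trans (≤-reflexive (trans (cong (λ l → M * length l) (filter-none (w ∈?_) none)) (*-zeroʳ M))) z≤n
      where
      none : All (λ e → ¬ (w ∈ e)) H-out
      none = All.tabulate (λ e∈ w∈e → proj₂ (∈-filter⁻ (¬? ∘ Meets? K) {xs = H} e∈)
        (w , x∈p∩q⁺ (w∈e , ∈-comprehension⁺ Heavy? heavy)))

  -- With `s = 2 + i` this is the estimate `s * d / M ^ (s - 1) ≤ 1 / 2`. It is an equality for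
  -- `i = 0`; from then on the left side of the stated inequality at most quadruples, while the
  -- right side is multiplied by `M ≥ 4`.
  power-growth : ∀ i → 2 * ((2 + i) * d) ≤ M ^ suc i
  power-growth zero = ≤-reflexive (regroup d)
    where
    regroup : ∀ d → 2 * (2 * d) ≡ 4 * d * 1
    regroup = solve-∀
  power-growth (suc i) = begin
    2 * ((3 + i) * d)                ≤⟨ *-monoʳ-≤ 2 (*-monoˡ-≤ d (+-monoʳ-≤ 3 (m≤n*m i 4))) ⟩
    2 * ((3 + 4 * i) * d)            ≤⟨ *-monoʳ-≤ 2 (*-monoˡ-≤ d (+-monoˡ-≤ (4 * i) (m≤m+n 3 5))) ⟩
    2 * ((8 + 4 * i) * d)            ≡⟨ regroup i d ⟩
    4 * (2 * ((2 + i) * d))          ≤⟨ *-mono-≤ (m≤m*n 4 d) (power-growth i) ⟩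
    M * M ^ suc i                    ∎
    where
    open ≤-Reasoning
    regroup : ∀ i d → 2 * ((8 + 4 * i) * d) ≡ 4 * (2 * ((2 + i) * d))
    regroup = solve-∀

  -- The cover `S` distributes the edges over at most `(2 + i) * d` vertices. Each of these is a set
  -- of size 1, which `suc i` uncovered steps separate from size `2 + i`, so its degree is at most
  -- `β 1 / M ^ suc i`.
  uncovered-bound : ∀ i {S} → ∣ S ∣ ≡ 2 + i → Cover S → (∀ {S} → ∣ S ∣ < 2 + i → ¬ Cover S) → 2 * length H ≤ β 1
  uncovered-bound i {S} ∣S∣≡ cover uncovered = *-cancelˡ-≤ (M ^ suc i) ⦃ m^n≢0 M (suc i) ⦄ (begin
    M ^ suc i * (2 * length H)         ≡⟨ regroup (M ^ suc i) (length H) ⟩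
    2 * (M ^ suc i * length H)         ≤⟨ *-monoʳ-≤ 2 (touching-bound degree≤Δ (M ^ suc i) (β 1) S H (All.lookup cover) vertex) ⟩
    2 * (∣ S ∣ * (d * β 1))            ≡⟨ cong (λ z → 2 * (z * (d * β 1))) ∣S∣≡ ⟩
    2 * ((2 + i) * (d * β 1))          ≡⟨ regroup′ (2 + i) d (β 1) ⟩
    2 * ((2 + i) * d) * β 1            ≤⟨ *-monoˡ-≤ (β 1) (power-growth i) ⟩
    M ^ suc i * β 1                    ∎)
    where
    open ≤-Reasoning
    regroup : ∀ m l → m * (2 * l) ≡ 2 * (m * l)
    regroup = solve-∀
    regroup′ : ∀ s d b → 2 * (s * (d * b)) ≡ 2 * (s * d) * b
    regroup′ = solve-∀
    vertex : ∀ {v w} → v ∈ S → w ∈ N[ v ] → M ^ suc i * length (filter (w ∈?_) H) ≤ β 1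
    vertex {w = w} _ _ = begin
      M ^ suc i * length (filter (w ∈?_) H)    ≤⟨ *-monoʳ-≤ (M ^ suc i) (vertex-degree w) ⟩
      M ^ suc i * deg ⁅ w ⁆                    ≤⟨ deg-decay (2 + i) uncovered (suc i) ⁅ w ⁆ (cong (_+ suc i) (∣⁅x⁆∣≡1 w)) ⟩
      β ∣ ⁅ w ⁆ ∣                              ≡⟨ cong β (∣⁅x⁆∣≡1 w) ⟩
      β 1                                      ∎

  -- The second alternative is `∣H∣ ≤ (ω - 1/2) β 1`, multiplied by 4 to clear denominators. The
  -- slack of half a `β 1` is what later absorbs the second-order term in the size of the
  -- competitor.
  dichotomy : ∀ {ω} → 1 ≤ ω → ω ≤ ∣ K ∣ ⊎ 4 * length H + 2 * β 1 ≤ 4 * (ω * β 1)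
  dichotomy {ω} 1≤ω with ω ≤? ∣ K ∣
  ... | yes ω≤∣K∣ = inj₁ ω≤∣K∣
  ... | no ω≰∣K∣ = inj₂ small-family
    where
    open ≤-Reasoning
    few : 2 * length H ≤ β 1 → 4 * length H + 2 * β 1 ≤ 4 * (ω * β 1)
    few le = begin
      4 * length H + 2 * β 1             ≡⟨ regroup (length H) (β 1) ⟩
      2 * (2 * length H) + 2 * β 1       ≤⟨ +-monoˡ-≤ (2 * β 1) (*-monoʳ-≤ 2 le) ⟩
      2 * β 1 + 2 * β 1                  ≡⟨ regroup′ (β 1) ⟩
      4 * (1 * β 1)                      ≤⟨ *-monoʳ-≤ 4 (*-monoˡ-≤ (β 1) 1≤ω) ⟩
      4 * (ω * β 1)                      ∎
      where
      regroup : ∀ l b → 4 * l + 2 * b ≡ 2 * (2 * l) + 2 * b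
      regroup = solve-∀
      regroup′ : ∀ b → 2 * b + 2 * b ≡ 4 * (1 * b)
      regroup′ = solve-∀
    CoverSize : ℕ → Set
    CoverSize s = ∃ λ S → ∣ S ∣ ≡ s × Cover S
    CoverSize? : Decidable CoverSize
    CoverSize? s = anySubset? (λ S → ∣ S ∣ ≟ s ×-dec Cover? S)
    by-cover-size : ∀ {e} → e LM.∈ H → ∀ s → CoverSize s → (∀ {j} → j < s → ¬ CoverSize j) →
      4 * length H + 2 * β 1 ≤ 4 * (ω * β 1)
    by-cover-size e∈H zero (S , ∣S∣≡0 , cover) _ with v , v∈S , _ ← All.lookup cover e∈H =
      contradiction (subst (0 <_) ∣S∣≡0 (x∈p⇒0<∣p∣ v∈S)) λ ()
    by-cover-size _ (suc zero) (S , ∣S∣≡1 , cover) _ = begin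
      4 * length H + 2 * β 1                              ≡⟨ cong (λ z → 4 * z + 2 * β 1) (length-filter-split (Meets? K) H) ⟨
      4 * (length H-in + length H-out) + 2 * β 1          ≡⟨ regroup (length H-in) (length H-out) (β 1) ⟩
      4 * length H-in + 4 * length H-out + 2 * β 1        ≤⟨ +-monoˡ-≤ (2 * β 1) (+-mono-≤ (*-monoʳ-≤ 4 H-in-bound) (H-out-bound ∣S∣≡1 cover)) ⟩
      -- Since `∣ K ∣ < ω`, there are four copies of `β 1` to spend: one pays for `H-out`, two are
      -- the required slack and one is spare.
      4 * (∣ K ∣ * β 1) + β 1 + 2 * β 1                   ≤⟨ m≤m+n _ (β 1) ⟩
      4 * (∣ K ∣ * β 1) + β 1 + 2 * β 1 + β 1             ≡⟨ regroup′ (∣ K ∣) (β 1) ⟩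
      4 * (suc ∣ K ∣ * β 1)                               ≤⟨ *-monoʳ-≤ 4 (*-monoˡ-≤ (β 1) (≰⇒> ω≰∣K∣)) ⟩
      4 * (ω * β 1)                                       ∎
      where
      regroup : ∀ x y b → 4 * (x + y) + 2 * b ≡ 4 * x + 4 * y + 2 * b
      regroup = solve-∀
      regroup′ : ∀ x b → 4 * (x * b) + b + 2 * b + b ≡ 4 * (suc x * b)
      regroup′ = solve-∀
    by-cover-size _ (suc (suc i)) (S , ∣S∣≡ , cover) minimal =
      few (uncovered-bound i ∣S∣≡ cover (λ lt c → minimal lt (_ , refl , c)))
    small-family : 4 * length H + 2 * β 1 ≤ 4 * (ω * β 1)
    small-family with empty-or-inhabited H
    ... | inj₁ H≡[] = few (subst (λ l → 2 * length l ≤ β 1) (sym H≡[]) z≤n)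
    -- Any edge is itself a cover, as `H` is intersecting; hence cover sizes exist and a least one
    -- can be chosen.
    ... | inj₂ (e , e∈H)
      with s , cover , minimal ← least CoverSize? k (e , size e∈H , All.tabulate (intersecting⇒touches intersecting e∈H)) =
      by-cover-size e∈H s cover minimal

  -- Comparison with the clique number

  module _ {ω : ℕ} (cliqueNumber : CliqueNumber G ω) where

    1≤ω : 1 ≤ ω
    1≤ω = go (≤-trans 1≤k k≤n)
      where
      go : 0 < n → 1 ≤ ω
      go (s≤s _) = subst (_≤ ω) (∣⁅x⁆∣≡1 {n} zero) (proj₂ cliqueNumber ⁅ zero ⁆ (singleton-clique zero))

    K₀ : Subset n
    K₀ = proj₁ (proj₁ cliqueNumber)

    K₀-clique : IsClique G K₀
    K₀-clique = proj₁ (proj₂ (proj₁ cliqueNumber))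

    ∣K₀∣≡ω : ∣ K₀ ∣ ≡ ω
    ∣K₀∣≡ω = proj₂ (proj₂ (proj₁ cliqueNumber))

    ω≤n : ω ≤ n
    ω≤n = subst (_≤ n) ∣K₀∣≡ω (∣p∣≤n K₀)

    ω≤d : ω ≤ d
    ω≤d with v , v∈ ← 0<∣p∣⇒Nonempty K₀ (subst (0 <_) (sym ∣K₀∣≡ω) 1≤ω) =
      subst (_≤ d) ∣K₀∣≡ω (m+n≤o⇒n≤o _ (outer-neighbours degree≤Δ K₀-clique v∈))

    -- By `meeting-lower`, the `k`-sets meeting an `ω`-set number at least `ω * β 1` minus
    -- `ω * ω * β 2`. As `ω ≤ d`, the error is at most `β 1 / 4`, less than the available slack
    -- `β 1 / 2`; strictness comes from `β 1 > 0`.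
    small⇒below : 4 * length H + 2 * β 1 ≤ 4 * (ω * β 1) → length H + (n ∸ ω) C k < n C k
    small⇒below small = *-cancelˡ-< 4 _ _ (+-cancelʳ-< (β 1) _ _ (begin-strict
      4 * (length H + x) + β 1                   <⟨ m<m+n _ 0<β1 ⟩
      4 * (length H + x) + β 1 + β 1             ≡⟨ regroup (length H) x (β 1) ⟩
      (4 * length H + 2 * β 1) + 4 * x           ≤⟨ +-monoˡ-≤ (4 * x) small ⟩
      4 * (ω * β 1) + 4 * x                      ≡⟨ regroup′ (ω * β 1) x ⟩
      4 * (x + ω * β 1)                          ≤⟨ *-monoʳ-≤ 4 (meeting-lower n k′ ω ω≤n) ⟩
      4 * (n C k + ω * ω * β 2)                  ≡⟨ *-distribˡ-+ 4 (n C k) (ω * ω * β 2) ⟩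
      4 * (n C k) + 4 * (ω * ω * β 2)            ≤⟨ +-monoʳ-≤ (4 * (n C k)) second-order ⟩
      4 * (n C k) + β 1                          ∎))
      where
      open ≤-Reasoning
      x = (n ∸ ω) C k
      regroup : ∀ l x b → 4 * (l + x) + b + b ≡ (4 * l + 2 * b) + 4 * x
      regroup = solve-∀
      regroup′ : ∀ a x → 4 * a + 4 * x ≡ 4 * (x + a)
      regroup′ = solve-∀
      regroup″ : ∀ d b → 4 * (d * d * b) ≡ 4 * d * (1 * (d * b))
      regroup″ = solve-∀
      0<β1 : 0 < β 1
      0<β1 = 0<nCk (∸-monoˡ-≤ 1 k≤n)
      second-order : 4 * (ω * ω * β 2) ≤ β 1
      second-order = begin
        4 * (ω * ω * β 2)        ≤⟨ *-monoʳ-≤ 4 (*-monoˡ-≤ (β 2) (*-mono-≤ ω≤d ω≤d)) ⟩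
        4 * (d * d * β 2)        ≡⟨ regroup″ d (β 2) ⟩
        M * (1 * (d * β 2))      ≤⟨ *-monoʳ-≤ M (*-monoˡ-≤ (d * β 2) 1≤k) ⟩
        M * (k * (d * β 2))      ≤⟨ β-decay 1 ⟩
        β 1                      ∎

    -- The case where the heavy vertices form a maximum clique

    module _ (ω≤∣K∣ : ω ≤ ∣ K ∣) where

      ∣K∣≡ω : ∣ K ∣ ≡ ω
      ∣K∣≡ω = ≤-antisym (proj₂ cliqueNumber K K-clique) ω≤∣K∣

      K-maximum : IsMaximumClique G K
      K-maximum = K-clique , λ K′ clique → ≤-trans (proj₂ cliqueNumber K′ clique) ω≤∣K∣

      OuterNeighbour : Fin n → Set
      OuterNeighbour u = ∃ λ v → v ∈ K × u ∈ neighbourhood G v ─ K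

      OuterNeighbour? : Decidable OuterNeighbour
      OuterNeighbour? u = any? (λ v → v ∈? K ×-dec u ∈? neighbourhood G v ─ K)

      W : Subset n
      W = comprehension OuterNeighbour?

      W-outside : ∀ {u} → u ∈ W → u ∉ K
      W-outside u∈W with v , _ , u∈ ← ∈-comprehension⁻ OuterNeighbour? u∈W = x∈p─q⇒x∉q (neighbourhood G v) K u∈

      ∣W∣-bound : ∣ W ∣ ≤ ω * (Δ + 1 ∸ ω)
      ∣W∣-bound = subst (λ z → ∣ W ∣ ≤ z * (Δ + 1 ∸ ω)) ∣K∣≡ω
        (∣⋃∣-bound K (λ v → neighbourhood G v ─ K) (Δ + 1 ∸ ω) W (∈-comprehension⁻ OuterNeighbour?) (λ {v} v∈K →
          m+n≤o⇒m≤o∸n (∣ neighbourhood G v ─ K ∣)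
            (subst (∣ neighbourhood G v ─ K ∣ + ω ≤_) (+-comm 1 Δ)
              (subst (λ z → ∣ neighbourhood G v ─ K ∣ + z ≤ d) ∣K∣≡ω (outer-neighbours degree≤Δ K-clique v∈K)))))

      -- An edge missing K is adjacent to every vertex of K, and no single
      -- vertex outside K is, since K cannot be enlarged.
      two-outer-neighbours : ∀ {e} → e LM.∈ H-out → ∃ λ i → ∃ λ j → i ≢ j × (i ∈ W × i ∈ e) × (j ∈ W × j ∈ e)
      two-outer-neighbours {e} e∈ with e∈H , misses ← ∈-filter⁻ (¬? ∘ Meets? K) {xs = H} e∈
        with v , v∈K ← 0<∣p∣⇒Nonempty K (≤-trans 1≤ω ω≤∣K∣) = second
        where
        neighbour-in-e : ∀ {v} → v ∈ K → ∃ λ w → w ∈ e × w ∈ W × Adjacent G v w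
        neighbour-in-e {v} v∈K
          with x , w , x∈ , w∈e , w∈N ← touches⁻ (All.lookup (heavy⇒cover (∈-comprehension⁻ Heavy? v∈K)) e∈H)
          with refl ← x∈⁅y⁆⇒x≡y v x∈ with ∈-N⁻ w∈N
        ... | inj₁ refl = contradiction (w , x∈p∩q⁺ (w∈e , v∈K)) misses
        ... | inj₂ vw   = w , w∈e , ∈-comprehension⁺ OuterNeighbour? (v , v∈K ,
          x∈p∧x∉q⇒x∈p─q (∈-neighbourhood⁺ vw) (λ w∈K → misses (w , x∈p∩q⁺ (w∈e , w∈K)))) , vw
        second : ∃ λ i → ∃ λ j → i ≢ j × (i ∈ W × i ∈ e) × (j ∈ W × j ∈ e)
        second with w , w∈e , w∈W , _ ← neighbour-in-e v∈K
          with any? (λ u → u ∈? K ×-dec ¬? (adj G u w ≟B true))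
        -- The vertex `w′` is adjacent to `u` and `w` is not, so they differ.
        ... | yes (u , u∈K , ¬uw) with w′ , w′∈e , w′∈W , uw′ ← neighbour-in-e u∈K =
          w , w′ , (λ { refl → ¬uw uw′ }) , (w∈W , w∈e) , (w′∈W , w′∈e)
        ... | no all-adjacent = contradiction
          (≤-trans (s≤s ω≤∣K∣) (subst (_≤ ω) (∣p∪⁅x⁆∣≡1+∣p∣ K (W-outside w∈W))
            (proj₂ cliqueNumber (K ∪ ⁅ w ⁆) (clique-extend K-clique joined))))
          1+n≰n
          where
          joined : ∀ {u} → u ∈ K → Adjacent G u w
          joined {u} u∈K = decidable-stable (adj G u w ≟B true) (λ ¬uw → all-adjacent (u , u∈K , ¬uw))

      -- Each edge is charged to a pair in `W`. It avoids the `ω` vertices of `K` as well, so after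
      -- the pair is fixed its other vertices come from `n ∸ ω ∸ 2` points.
      H-out-pairs : length H-out ≤ (∣ W ∣ C 2) * extensions (n ∸ ω ∸ 2) k 2
      H-out-pairs = pair-bound (λ i e → i ∈? e) _ W H-out two-outer-neighbours through-pair
        where
        through-pair : ∀ {i j} → i ≢ j → i ∈ W → j ∈ W →
          length (filter (λ e → i ∈? e ×-dec j ∈? e) H-out) ≤ extensions (n ∸ ω ∸ 2) k 2
        through-pair {i} {j} i≢j i∈W j∈W = subst₂ (λ a b → length (filter both? H-out) ≤ extensions (n ∸ a ∸ b) k b)
          ∣K∣≡ω (trans (∣p∪⁅x⁆∣≡1+∣p∣ ⁅ i ⁆ (λ j∈ → i≢j (sym (x∈⁅y⁆⇒x≡y i j∈)))) (cong suc (∣⁅x⁆∣≡1 i)))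
          (count-bound (⁅ i ⁆ ∪ ⁅ j ⁆) K k (Unique.filter⁺ both? (Unique.filter⁺ (¬? ∘ Meets? K) (proj₁ uniform)))
            (λ x∈ → W-outside (pair⊆ i∈W j∈W x∈)) admissible)
          where
          both? : Decidable (λ e → i ∈ e × j ∈ e)
          both? e = i ∈? e ×-dec j ∈? e
          pair⊆ : ∀ {p} → i ∈ p → j ∈ p → ⁅ i ⁆ ∪ ⁅ j ⁆ ⊆ p
          pair⊆ {p} i∈p j∈p x∈ with x∈p∪q⁻ ⁅ i ⁆ ⁅ j ⁆ x∈
          ... | inj₁ x∈i = subst (_∈ p) (sym (x∈⁅y⁆⇒x≡y i x∈i)) i∈p
          ... | inj₂ x∈j = subst (_∈ p) (sym (x∈⁅y⁆⇒x≡y j x∈j)) j∈p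
          admissible : ∀ {e} → e LM.∈ filter both? H-out → ∣ e ∣ ≡ k × ⁅ i ⁆ ∪ ⁅ j ⁆ ⊆ e × Disjoint e K
          admissible e∈ with e∈out , i∈e , j∈e ← ∈-filter⁻ both? {xs = H-out} e∈
            with e∈H , misses ← ∈-filter⁻ (¬? ∘ Meets? K) {xs = H} e∈out =
            size e∈H , (λ {x} → pair⊆ i∈e j∈e {x}) , λ x∈e x∈K → misses (_ , x∈p∩q⁺ (x∈e , x∈K))

      heavy-clique-bound : length H ≤ bound n k Δ ω
      heavy-clique-bound = begin
        length H                                                    ≡⟨ length-filter-split (Meets? K) H ⟨
        length H-in + length H-out                                  ≤⟨ +-mono-≤ in-part out-part ⟩
        bound n k Δ ω                                               ∎
        where
        open ≤-Reasoning
        in-part : length H-in ≤ n C k ∸ (n ∸ ω) C k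
        in-part = m+n≤o⇒m≤o∸n (length H-in)
          (subst (λ z → length H-in + (n ∸ z) C k ≤ n C k) ∣K∣≡ω (meeting-upper K H uniform))
        out-part : length H-out ≤ ((ω * (Δ + 1 ∸ ω)) C 2) * binomMinus2 (n ∸ ω ∸ 2) k
        out-part = ≤-trans H-out-pairs
          (*-mono-≤ (C-monoˡ-≤ 2 ∣W∣-bound) (≤-reflexive (sym (binomMinus2≡extensions (n ∸ ω ∸ 2) k))))

      -- Against old edges `e` is handled by `K-touches`; the pair of `e` with itself is covered by
      -- the clique property, since `e` meets `K`.
      add-edge : ∀ {e} → ∣ e ∣ ≡ k → Nonempty (e ∩ K) → ¬ e LM.∈ H → UniformHG k (e ∷ H) × GIntersecting G (e ∷ H)
      add-edge {e} ∣e∣≡k meets e∉H =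
        (All.tabulate (λ f∈H e≡f → e∉H (subst (LM._∈ H) (sym e≡f) f∈H)) ∷ proj₁ uniform , ∣e∣≡k ∷ proj₂ uniform) ,
        touches⇒intersecting touch
        where
        touch : ∀ {f g} → f LM.∈ e ∷ H → g LM.∈ e ∷ H → Touches f g
        touch (here refl) (here refl) = clique-touches K-clique meets meets
        touch (here refl) (there g∈H) = K-touches meets g∈H
        touch (there f∈H) (here refl) = touches-sym (K-touches meets f∈H)
        touch (there f∈H) (there g∈H) = intersecting⇒touches intersecting f∈H g∈H

    upper-bound : length H ≤ bound n k Δ ω
    upper-bound with dichotomy 1≤ω
    ... | inj₁ ω≤∣K∣ = heavy-clique-bound ω≤∣K∣
    -- In this case the first summand of `bound` alone exceeds `length H`.
    ... | inj₂ small = ≤-trans (m+n≤o⇒m≤o∸n (length H) (<⇒≤ (small⇒below small))) (m≤m+n _ _)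

    maximum-contains-star : (∀ H′ → UniformHG k H′ → GIntersecting G H′ → length H′ ≤ length H) →
      ∃ λ K → IsMaximumClique G K × (∀ e → ∣ e ∣ ≡ k → Nonempty (e ∩ K) → e LM.∈ H)
    maximum-contains-star maximum with dichotomy 1≤ω
    ... | inj₁ ω≤∣K∣ = K , K-maximum ω≤∣K∣ , contains
      where
      open DecMembership (≡-dec _≟B_) using () renaming (_∈?_ to _∈H?_)
      contains : ∀ e → ∣ e ∣ ≡ k → Nonempty (e ∩ K) → e LM.∈ H
      contains e ∣e∣≡k meets with e ∈H? H
      ... | yes e∈H = e∈H
      ... | no e∉H with unif , int ← add-edge ω≤∣K∣ ∣e∣≡k meets e∉H = contradiction (maximum (e ∷ H) unif int) 1+n≰n
    -- The family of all `k`-sets meeting `K₀` is `G`-intersecting and would be strictly larger than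
    -- `H`, against maximality.
    ... | inj₂ small = contradiction
      (≤-<-trans
        (≤-trans (length-meeting K₀ k)
          (+-mono-≤ (maximum (meeting K₀ k) (meeting-uniform K₀ k) (meeting-intersecting K₀-clique k))
            (≤-reflexive (cong (λ z → (n ∸ z) C k) ∣K₀∣≡ω))))
        (small⇒below small))
      (<-irrefl refl)

-- The case k = 0 and the passage from rationals to naturals

module _ {n : ℕ} (G : Graph n) where

  open Touching G

  -- `GIntersecting` includes the pair of an edge with itself, which forces every edge to be
  -- nonempty.
  zero-uniform-empty : ∀ {H} → UniformHG 0 H → GIntersecting G H → H ≡ []
  zero-uniform-empty {H} (_ , sizes) int with empty-or-inhabited H
  ... | inj₁ H≡[] = H≡[]
  ... | inj₂ (e , e∈) with v , v∈ , _ ← intersecting⇒touches int e∈ e∈ =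
    contradiction (subst (0 <_) (All.lookup sizes e∈) (x∈p⇒0<∣p∣ v∈)) λ ()

-- The hypothesis `k < C √n` is given in squared form. Over unnormalised rationals, where no common
-- factors are cancelled, the comparison unfolds to a cross-multiplication of integers.
square-bound : ∀ q k n → ℕ→ℚ k ℚ.* ℕ→ℚ k ℚ.< (ℤ.+ 1 ℚ./ suc q) ℚ.* (ℤ.+ 1 ℚ./ suc q) ℚ.* ℕ→ℚ n →
  suc q * suc q * (k * k) < n
square-bound q k n lt = ℤ.drop‿+<+ (subst₂ ℤ._<_ numeratorˡ numeratorʳ
  (ℚᵘ.drop-*<* (ℚᵘ.<-respˡ-≃ left (ℚᵘ.<-respʳ-≃ right (ℚ.toℚᵘ-mono-< lt)))))
  where
  c = ℤ.+ 1 ℚ./ suc q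
  cᵘ = mkℚᵘ (ℤ.+ 1) q
  kᵘ = mkℚᵘ (ℤ.+ k) 0
  nᵘ = mkℚᵘ (ℤ.+ n) 0
  left : ℚ.toℚᵘ (ℕ→ℚ k ℚ.* ℕ→ℚ k) ℚᵘ.≃ kᵘ ℚᵘ.* kᵘ
  left = ℚᵘ.≃-trans (ℚ.toℚᵘ-homo-* (ℕ→ℚ k) (ℕ→ℚ k)) (ℚᵘ.*-cong (ℚ.toℚᵘ-fromℚᵘ kᵘ) (ℚ.toℚᵘ-fromℚᵘ kᵘ))
  right : ℚ.toℚᵘ (c ℚ.* c ℚ.* ℕ→ℚ n) ℚᵘ.≃ cᵘ ℚᵘ.* cᵘ ℚᵘ.* nᵘ
  right = ℚᵘ.≃-trans (ℚ.toℚᵘ-homo-* (c ℚ.* c) (ℕ→ℚ n))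
    (ℚᵘ.*-cong (ℚᵘ.≃-trans (ℚ.toℚᵘ-homo-* c c) (ℚᵘ.*-cong (ℚ.toℚᵘ-fromℚᵘ cᵘ) (ℚ.toℚᵘ-fromℚᵘ cᵘ))) (ℚ.toℚᵘ-fromℚᵘ nᵘ))
  numeratorˡ : (ℤ.+ k ℤ.* ℤ.+ k) ℤ.* ℤ.+ (suc q * suc q * 1) ≡ ℤ.+ (suc q * suc q * (k * k))
  numeratorˡ = trans (cong (ℤ._* ℤ.+ (suc q * suc q * 1)) (sym (ℤ.pos-* k k)))
    (trans (sym (ℤ.pos-* (k * k) (suc q * suc q * 1))) (cong ℤ.+_ (regroup (suc q) (k * k))))
    where
    regroup : ∀ q x → x * (q * q * 1) ≡ q * q * x
    regroup = solve-∀
  numeratorʳ : (ℤ.+ 1 ℤ.* ℤ.+ n) ℤ.* ℤ.+ 1 ≡ ℤ.+ n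
  numeratorʳ = trans (ℤ.*-identityʳ (ℤ.+ 1 ℤ.* ℤ.+ n)) (ℤ.*-identityˡ (ℤ.+ n))

theorem2 : (Δ ω : ℕ) →
    Σ ℚ λ C → Positive C ×
      (∀ (n : ℕ) (G : Graph n) → MaxDegree G Δ → CliqueNumber G ω →
        ∀ (k : ℕ) → ℕ→ℚ k ℚ.* ℕ→ℚ k ℚ.< C ℚ.* C ℚ.* ℕ→ℚ n →
          (∀ (H : Hypergraph n) → UniformHG k H → GIntersecting G H →
            length H ≤ bound n k Δ ω)
          ×
          (∀ (H : Hypergraph n) → UniformHG k H → GIntersecting G H →
            (∀ (H' : Hypergraph n) → UniformHG k H' → GIntersecting G H' →
              length H' ≤ length H) →
            ∃ λ K → IsMaximumClique G K ×
              (∀ (e : Subset n) → ∣ e ∣ ≡ k → Nonempty (e ∩ K) → e LM.∈ H)))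
theorem2 Δ ω = ℤ.+ 1 ℚ./ suc q , ℚ.normalize-pos 1 (suc q) , main
  where
  -- suc q is definitionally 2 * suc Δ
  q = Δ + suc (Δ + 0)
  square : ∀ d x → (2 * d) * (2 * d) * x ≡ 4 * d * d * x
  square = solve-∀
  main : ∀ n (G : Graph n) → MaxDegree G Δ → CliqueNumber G ω → ∀ k →
    ℕ→ℚ k ℚ.* ℕ→ℚ k ℚ.< (ℤ.+ 1 ℚ./ suc q) ℚ.* (ℤ.+ 1 ℚ./ suc q) ℚ.* ℕ→ℚ n →
    (∀ H → UniformHG k H → GIntersecting G H → length H ≤ bound n k Δ ω) ×
    (∀ H → UniformHG k H → GIntersecting G H → (∀ H′ → UniformHG k H′ → GIntersecting G H′ → length H′ ≤ length H) →
      ∃ λ K → IsMaximumClique G K × (∀ e → ∣ e ∣ ≡ k → Nonempty (e ∩ K) → e LM.∈ H))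
  -- `Family` takes the size in the form `suc k′`, so size 0 is treated apart: `H` is empty, and no
  -- set of size 0 meets `K₀`.
  main n G (degree≤Δ , _) ((K₀ , clique , ∣K₀∣≡ω) , maximal) zero _ =
    (λ H unif int → subst (λ l → length l ≤ bound n 0 Δ ω) (sym (zero-uniform-empty G unif int)) z≤n) ,
    λ _ _ _ _ → K₀ , (clique , λ K′ c → subst (∣ K′ ∣ ≤_) (sym ∣K₀∣≡ω) (maximal K′ c)) ,
      λ e ∣e∣≡0 (x , x∈) → contradiction (subst (0 <_) ∣e∣≡0 (x∈p⇒0<∣p∣ (proj₁ (x∈p∩q⁻ e K₀ x∈)))) λ ()
  main n G (degree≤Δ , _) cliqueNumber (suc k) lt =
    (λ H unif int → Family.upper-bound G degree≤Δ large H unif int cliqueNumber) ,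
    λ H unif int → Family.maximum-contains-star G degree≤Δ large H unif int cliqueNumber
    where
    large : 4 * suc Δ * suc Δ * (suc k * suc k) ≤ n
    large = subst (_≤ n) (square (suc Δ) (suc k * suc k)) (<⇒≤ (square-bound q (suc k) n lt))
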